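{- Let $\mu$ be a diagram containing $d$ boxes on the main diagonal. The dual Schur function $\widehat s_\mu(x\|a)$ can be written as the series $$\widehat s_\mu(x\|a)=\sum_\lambda(-1)^{n(\lambda/\mu)}\det\big[h_{\lambda_i-\mu_j-i+j}(a_0,a_{ -1},\dots,a_{j-\mu_j})\big]_{i,j=1}^d\;\det\big[e_{\lambda_i-\mu_j-i+j}(a_1,a_2,\dots,a_{j-\mu_j-1})\big]_{i,j=d+1}^{n}\;s_\lambda(x),$$ summed over diagrams $\lambda$ which contain $\mu$ and such that $\lambda$ has $d$ boxes on the main diagonal, where $n=\ell(\lambda)$ in the second determinant and $n(\lambda/\mu)$ denotes the total number of boxes of $\lambda/\mu$ in rows $d+1,d+2,\dots,\ell(\lambda)$.
   Context: Let $a=(a_i)_{i\in\mathbb Z}$ be a sequence of commuting indeterminates and $\mathbb Q[a]$ the polynomial ring in the $a_i$; $x=(x_1,x_2,\dots)$; $\ell(\lambda)$ is the number of nonzero parts of $\lambda$; $s_\lambda(x)$ are the ordinary Schur functions. $h_k(\cdot)$ and $e_k(\cdot)$ are the usual complete and elementary symmetric polynomials in the indicated (possibly empty) finite set of variables, with $h_0=e_0=1$ and $h_k=e_k=0$ for $k<0$; an empty determinant is $1$. Dual Schur functions: let $\widehat\Lambda(x\|a)$ be the ring of formal (possibly infinite) sums $\sum_{\lambda}c_\lambda(a)s_\lambda(x)$, $c_\lambda(a)\in\mathbb Q[a]$. For a partition $\mu$ with $d$ boxes on the main diagonal and $N\geqslant\ell(\mu)$, $$\widehat s_\mu(x_1,\dots,x_N\|a)=\frac{\det[A_{ij}]_{i,j=1}^N}{\prod_{1\leqslant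 i<j\leqslant N}(x_i-x_j)},$$ where $A_{ij}=\dfrac{x_i^{\mu_j+N-j}}{(1-a_0x_i)(1-a_{ -1}x_i)\cdots(1-a_{j-\mu_j}x_i)}$ for $1\leqslant j\leqslant d$ and $A_{ij}=x_i^{\mu_j+N-j}(1-a_1x_i)\cdots(1-a_{j-\mu_j-1}x_i)$ for $d<j\leqslant N$; it is $0$ if $\ell(\mu)>N$. These are compatible with setting $x_N=0$ and define $\widehat s_\mu(x\|a)\in\widehat\Lambda(x\|a)$. -}

module Defs where

open import Level using (0ℓ)
open import Algebra.Bundles using (CommutativeRing)
open import Algebra.Bundles.Raw using (RawRing)
import Algebra.Definitions.RawSemiring as RawSemiringDefinitions
open import Data.Bool using (if_then_else_)
open import Data.Fin using (Fin; zero; suc; toℕ; punchIn)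
import Data.Fin as Fin
open import Data.Integer using (ℤ; +_; -[1+_])
import Data.Integer as ℤ
open import Data.List using (List; []; _∷_; _++_; map; foldr; concatMap; mapMaybe; filter; length; upTo; allFin; cartesianProduct; cartesianProductWith)
open import Data.List.Relation.Binary.Prefix.Heterogeneous using (Prefix)
open import Data.List.Relation.Binary.Prefix.Heterogeneous.Properties using (prefix?)
open import Data.List.Relation.Unary.All using (All; all?)
open import Data.List.Relation.Unary.Linked using (Linked; linked?)
open import Data.Maybe using (Maybe)
import Data.Maybe as Maybe
open import Data.Nat using (ℕ; zero; suc; _∸_; _≤_; _<_; _≥_; _≤?_; _<?_; _≥?_; _≟_)
import Data.Nat as ℕ
import Data.Nat.ListAction as ℕ
open import Data.Product using (_×_; _,_)
open import Data.Rational using (ℚ; 0ℚ; 1ℚ)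
import Data.Rational as ℚ
open import Data.Vec using (Vec; []; _∷_; replicate; lookup; updateAt)
import Data.Vec as Vec
import Data.Vec.Properties as Vec
open import Relation.Nullary using (Dec; does)
open import Relation.Nullary.Decidable using (_×-dec_; dec⇒maybe)

------------------------------------------------------------------------
-- Partitions

-- Rows and columns are numbered from 0 throughout, so index i here is
-- i + 1 in the usual 1-based convention.

record Partition : Set where
  constructor partition
  field
    parts      : List ℕ
    decreasing : Linked _≥_ parts
    positive   : All (0 <_) parts

open Partition public

nth : List ℕ → ℕ → ℕ
nth []       _       = 0
nth (k ∷ _)  zero    = k
nth (_ ∷ ks) (suc i) = nth ks i

infix 9 _⟨_⟩

_⟨_⟩ : Partition → ℕ → ℕ
ν ⟨ i ⟩ = nth (parts ν) i

ℓ : Partition → ℕ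
ℓ ν = length (parts ν)

diagonal : Partition → ℕ
diagonal ν = length (filter (λ i → i <? ν ⟨ i ⟩) (upTo (ℓ ν)))

infix 4 _⊆_ _⊆?_

_⊆_ : Partition → Partition → Set
μ ⊆ ν = Prefix _≤_ (parts μ) (parts ν)

_⊆?_ : (μ ν : Partition) → Dec (μ ⊆ ν)
μ ⊆? ν = prefix? _≤?_ (parts μ) (parts ν)

-- A composition of m + 1 arises from exactly one composition of m,
-- either by prepending a part 1 or by increasing the first part.
compositions : ℕ → List (List ℕ)
compositions zero    = [] ∷ []
compositions (suc m) = concatMap grow (compositions m)
  where
  grow : List ℕ → List (List ℕ)
  grow []       = (1 ∷ []) ∷ []
  grow (k ∷ ks) = (1 ∷ k ∷ ks) ∷ (suc k ∷ ks) ∷ []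

toPartition? : List ℕ → Maybe Partition
toPartition? ks = Maybe.map (λ (d , p) → partition ks d p)
  (dec⇒maybe (linked? _≥?_ ks ×-dec all? (0 <?_) ks))

partitionsOf : ℕ → List Partition
partitionsOf m = mapMaybe toPartition? (compositions m)

------------------------------------------------------------------------
-- Symmetric polynomials and determinants

module _ {A : Set} where

  multisets : ℕ → List A → List (List A)
  multisets zero    _        = [] ∷ []
  multisets (suc k) []       = []
  multisets (suc k) (y ∷ ys) =
    map (y ∷_) (multisets k (y ∷ ys)) ++ multisets (suc k) ys

  subsets : ℕ → List A → List (List A)
  subsets zero    _        = [] ∷ []
  subsets (suc k) []       = []
  subsets (suc k) (y ∷ ys) = map (y ∷_) (subsets k ys) ++ subsets (suc k) ys

module RingOperations (R : RawRing 0ℓ 0ℓ) where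
  open RawRing R public
  open RawSemiringDefinitions rawSemiring public using (_^_; sum)

  ∑ : List Carrier → Carrier
  ∑ = foldr _+_ 0#

  ∏ : List Carrier → Carrier
  ∏ = foldr _*_ 1#

  h : ℤ → List Carrier → Carrier
  h (+ k)    ys = ∑ (map ∏ (multisets k ys))
  h -[1+ _ ] ys = 0#

  e : ℤ → List Carrier → Carrier
  e (+ k)    ys = ∑ (map ∏ (subsets k ys))
  e -[1+ _ ] ys = 0#

  det : ∀ {n} → (Fin n → Fin n → Carrier) → Carrier
  det {zero}  M = 1#
  det {suc n} M = sum λ j →
    (- 1#) ^ toℕ j * M zero j * det λ r s → M (suc r) (punchIn j s)

------------------------------------------------------------------------
-- Power series in x₀, …, x_{N-1}, given by their coefficients

-- All pairs (β , γ) with β + γ = α.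
splittings : ∀ {N} → Vec ℕ N → List (Vec ℕ N × Vec ℕ N)
splittings []      = ([] , []) ∷ []
splittings (k ∷ α) =
  cartesianProductWith (λ { i (β , γ) → (i ∷ β) , (k ∸ i ∷ γ) })
                       (upTo (suc k)) (splittings α)

module PowerSeries (R : RawRing 0ℓ 0ℓ) (N : ℕ) where
  private module R = RingOperations R

  Series : Set
  Series = Vec ℕ N → R.Carrier

  constant : R.Carrier → Series
  constant c α = if does (Vec.≡-dec _≟_ α (replicate N 0)) then c else R.0#

  rawRing : RawRing 0ℓ 0ℓ
  rawRing = record
    { Carrier = Series
    ; _≈_     = λ f g → ∀ α → f α R.≈ g α
    ; _+_     = λ f g α → f α R.+ g α
    ; _*_     = λ f g α →
                  R.∑ (map (λ { (β , γ) → f β R.* g γ }) (splittings α))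
    ; -_      = λ f α → R.- f α
    ; 0#      = λ _ → R.0#
    ; 1#      = constant R.1#
    }

  open RingOperations rawRing public

  -- The series Σₖ uₖ xᵢᵏ in the single variable xᵢ.
  inVariable : Fin N → (ℕ → R.Carrier) → Series
  inVariable i u α =
    if does (Vec.≡-dec _≟_ (updateAt α i (λ _ → 0)) (replicate N 0))
    then u (lookup α i) else R.0#

  x : Fin N → Series
  x i = inVariable i λ { 1 → R.1# ; _ → R.0# }

  -- 1 / (1 - c xᵢ) = Σₖ cᵏ xᵢᵏ
  geometric : R.Carrier → Fin N → Series
  geometric c i = inVariable i λ k → c R.^ k

  -- Exact division by xᵢ - xⱼ.  If f = (xᵢ - xⱼ) g, then comparing
  -- coefficients gives g_α = f_{α+eᵢ} + g_{α+eᵢ-eⱼ}, where the last term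
  -- is absent if αⱼ = 0.  Iterating until the exponent of xⱼ is used up,
  --   g_α = Σ_{k=0}^{αⱼ} f_{α+(k+1)eᵢ-k eⱼ}.
  -- The value is meaningful only for f divisible by xᵢ - xⱼ.
  divideByDifference : Fin N × Fin N → Series → Series
  divideByDifference (i , j) f α =
    R.∑ (map (λ k → f (updateAt (updateAt α i (λ m → m ℕ.+ suc k)) j (_∸ k)))
             (upTo (suc (lookup α j))))

  infixl 7 _/Vandermonde

  -- Exact division by ∏_{i<j} (xᵢ - xⱼ), one factor at a time.  It is
  -- applied only to determinants [fⱼ(xᵢ)]: these vanish on xᵢ = xⱼ, hence
  -- are divisible by the product, and the quotient is unique.
  _/Vandermonde : Series → Series
  f /Vandermonde = foldr divideByDifference f
    (filter (λ { (i , j) → i Fin.<? j })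
            (cartesianProduct (allFin N) (allFin N)))

------------------------------------------------------------------------
-- Schur functions and dual Schur functions, with coefficients in R

module Schur (R : RawRing 0ℓ 0ℓ) (a : ℤ → RawRing.Carrier R) where
  private module R = RingOperations R

  -- a₀, a₋₁, …, with m entries.  For μⱼ ≥ j (1-based) the list
  -- a₀, …, a_{j-μⱼ} has μⱼ - j + 1 entries.
  a₀,a₋₁,⋯ : ℕ → List R.Carrier
  a₀,a₋₁,⋯ m = map (λ k → a (ℤ.- (+ k))) (upTo m)

  -- a₁, a₂, …, with m entries.  For μⱼ < j (1-based) the list
  -- a₁, …, a_{j-μⱼ-1} has j - μⱼ - 1 entries.
  a₁,a₂,⋯ : ℕ → List R.Carrier
  a₁,a₂,⋯ m = map (λ k → a (+ suc k)) (upTo m)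

  schurPolynomial : Partition → (N : ℕ) → PowerSeries.Series R N
  schurPolynomial ν N = if does (ℓ ν ≤? N) then det A /Vandermonde else 0#
    where
    open PowerSeries R N
    A : Fin N → Fin N → Series
    A i j = x i ^ (ν ⟨ toℕ j ⟩ ℕ.+ (N ∸ suc (toℕ j)))

  dualSchurSeries : Partition → (N : ℕ) → PowerSeries.Series R N
  dualSchurSeries μ N = if does (ℓ μ ≤? N) then det A /Vandermonde else 0#
    where
    open PowerSeries R N
    A : Fin N → Fin N → Series
    A i j = x i ^ (μ ⟨ toℕ j ⟩ ℕ.+ (N ∸ suc (toℕ j))) *
      (if does (toℕ j <? diagonal μ)
       then ∏ (map (λ c → geometric c i) (a₀,a₋₁,⋯ (μ ⟨ toℕ j ⟩ ∸ toℕ j)))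
       else ∏ (map (λ c → 1# + - (constant c * x i))
                   (a₁,a₂,⋯ (toℕ j ∸ μ ⟨ toℕ j ⟩))))

  -- The formal sum Σ_ν f(ν) s_ν.
  Λ̂ : Set
  Λ̂ = Partition → R.Carrier

  -- Specialisation to N variables.  As s_ν is homogeneous of degree |ν|,
  -- the coefficient at x^α receives contributions only from |ν| = |α|.
  infix 8 _↾_

  _↾_ : Λ̂ → (N : ℕ) → PowerSeries.Series R N
  (f ↾ N) α =
    R.∑ (map (λ ν → f ν R.* schurPolynomial ν N α) (partitionsOf (Vec.sum α)))

  -- The dual Schur function of μ is the element of Λ̂ whose
  -- specialisation to N variables is dualSchurSeries μ N, for every N.
  IsDualSchurFunction : Partition → Λ̂ → Set
  IsDualSchurFunction μ f = ∀ N → PowerSeries._≈_ R N (f ↾ N) (dualSchurSeries μ N)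

  boxesBelow : ℕ → Partition → Partition → ℕ
  boxesBelow d ν μ =
    ℕ.sum (map (λ i → ν ⟨ d ℕ.+ i ⟩ ∸ μ ⟨ d ℕ.+ i ⟩) (upTo (ℓ ν ∸ d)))

  -- λᵢ - μⱼ - i + j
  index : Partition → Partition → ℕ → ℕ → ℤ
  index ν μ i j = + (ν ⟨ i ⟩) ℤ.- + (μ ⟨ j ⟩) ℤ.- + i ℤ.+ + j

  expansion : Partition → Λ̂
  expansion μ ν =
    if does (μ ⊆? ν ×-dec diagonal ν ≟ d)
    then (R.- R.1#) R.^ boxesBelow d ν μ R.* R.det H R.* R.det E
    else R.0#
    where
    d = diagonal μ

    H : Fin d → Fin d → R.Carrier
    H i j = R.h (index ν μ (toℕ i) (toℕ j))
                (a₀,a₋₁,⋯ (μ ⟨ toℕ j ⟩ ∸ toℕ j))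

    E : Fin (ℓ ν ∸ d) → Fin (ℓ ν ∸ d) → R.Carrier
    E i j = R.e (index ν μ (d ℕ.+ toℕ i) (d ℕ.+ toℕ j))
                (a₁,a₂,⋯ ((d ℕ.+ toℕ j) ∸ μ ⟨ d ℕ.+ toℕ j ⟩))

------------------------------------------------------------------------
-- The polynomial ring ℚ[aᵢ : i ∈ ℤ], as the free commutative ℚ-algebra
-- on the aᵢ: ring expressions modulo the congruence generated by the
-- commutative ring laws and the ring structure of ℚ.

infixl 6 _⊕_
infixl 7 _⊗_
infix  4 _≈ₚ_

data ℚ[a] : Set where
  con     : ℚ → ℚ[a]
  a       : ℤ → ℚ[a]
  _⊕_ _⊗_ : ℚ[a] → ℚ[a] → ℚ[a]
  ⊖_      : ℚ[a] → ℚ[a]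

data _≈ₚ_ : ℚ[a] → ℚ[a] → Set where
  reflₚ       : ∀ {p} → p ≈ₚ p
  symₚ        : ∀ {p q} → p ≈ₚ q → q ≈ₚ p
  transₚ      : ∀ {p q r} → p ≈ₚ q → q ≈ₚ r → p ≈ₚ r
  ⊕-cong      : ∀ {p p′ q q′} → p ≈ₚ p′ → q ≈ₚ q′ → p ⊕ q ≈ₚ p′ ⊕ q′
  ⊗-cong      : ∀ {p p′ q q′} → p ≈ₚ p′ → q ≈ₚ q′ → p ⊗ q ≈ₚ p′ ⊗ q′
  ⊖-cong      : ∀ {p p′} → p ≈ₚ p′ → ⊖ p ≈ₚ ⊖ p′
  ⊕-assoc     : ∀ p q r → (p ⊕ q) ⊕ r ≈ₚ p ⊕ (q ⊕ r)
  ⊕-comm      : ∀ p q → p ⊕ q ≈ₚ q ⊕ p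
  ⊕-identityˡ : ∀ p → con 0ℚ ⊕ p ≈ₚ p
  ⊖-inverseˡ  : ∀ p → ⊖ p ⊕ p ≈ₚ con 0ℚ
  ⊗-assoc     : ∀ p q r → (p ⊗ q) ⊗ r ≈ₚ p ⊗ (q ⊗ r)
  ⊗-comm      : ∀ p q → p ⊗ q ≈ₚ q ⊗ p
  ⊗-identityˡ : ∀ p → con 1ℚ ⊗ p ≈ₚ p
  distribˡ    : ∀ p q r → p ⊗ (q ⊕ r) ≈ₚ p ⊗ q ⊕ p ⊗ r
  con-⊕       : ∀ s t → con (s ℚ.+ t) ≈ₚ con s ⊕ con t
  con-⊗       : ∀ s t → con (s ℚ.* t) ≈ₚ con s ⊗ con t

ℚ[a]-commutativeRing : CommutativeRing 0ℓ 0ℓ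
ℚ[a]-commutativeRing = record
  { Carrier = ℚ[a]
  ; _≈_     = _≈ₚ_
  ; _+_     = _⊕_
  ; _*_     = _⊗_
  ; -_      = ⊖_
  ; 0#      = con 0ℚ
  ; 1#      = con 1ℚ
  ; isCommutativeRing = record
    { isRing = record
      { +-isAbelianGroup = record
        { isGroup = record
          { isMonoid = record
            { isSemigroup = record
              { isMagma = record
                { isEquivalence = record
                  { refl = reflₚ ; sym = symₚ ; trans = transₚ }
                ; ∙-cong = ⊕-cong
                }
              ; assoc = ⊕-assoc
              }
            ; identity = ⊕-identityˡ , λ p → transₚ (⊕-comm p _) (⊕-identityˡ p)
            }
          ; inverse = ⊖-inverseˡ , λ p → transₚ (⊕-comm p _) (⊖-inverseˡ p)
          ; ⁻¹-cong = ⊖-cong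
          }
        ; comm = ⊕-comm
        }
      ; *-cong = ⊗-cong
      ; *-assoc = ⊗-assoc
      ; *-identity = ⊗-identityˡ , λ p → transₚ (⊗-comm p _) (⊗-identityˡ p)
      ; distrib = distribˡ , λ p q r →
          transₚ (⊗-comm (q ⊕ r) p)
            (transₚ (distribˡ p q r) (⊕-cong (⊗-comm p q) (⊗-comm p r)))
      }
    ; *-comm = ⊗-comm
    }
  }

open Schur (CommutativeRing.rawRing ℚ[a]-commutativeRing) a public

{-# OPTIONS --safe #-}
module Submission where

open import Defs
open import Level using (0ℓ)
open import Algebra.Bundles using (CommutativeRing)
open import Algebra.Bundles.Raw using (RawRing)
import Algebra.Properties.CommutativeSemigroup as CommutativeSemigroupProperties
import Algebra.Properties.Ring as RingProperties
open import Data.Bool using (true; false; if_then_else_)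
open import Data.Empty using (⊥-elim)
open import Data.Fin using (Fin; zero; suc; toℕ; punchIn)
import Data.Fin as Fin
import Data.Fin.Properties as Fin
open import Data.Integer using (ℤ; +_; -[1+_]; _⊖_)
import Data.Integer as ℤ
import Data.Integer.Properties as ℤ
import Data.Integer.Solver as ℤ
open import Data.List using (List; []; _∷_; _++_; map; foldr; filter; length; mapMaybe; concatMap; tabulate; upTo; applyUpTo; allFin; cartesianProduct; cartesianProductWith)
open import Data.List.Properties using (++-identityʳ; ∷-injective; map-++; map-∘; map-cong; map-applyUpTo; map-tabulate; length-++; length-map; length-upTo; length-tabulate; filter-++; filter-all)
open import Data.List.Relation.Binary.Pointwise using (Pointwise; []; _∷_)
open import Data.List.Relation.Binary.Prefix.Heterogeneous using (Prefix; []; _∷_)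
open import Data.List.Relation.Unary.All as All using (All; []; _∷_)
import Data.List.Relation.Unary.All.Properties as All
open import Data.List.Relation.Unary.Linked using (Linked; []; [-]; _∷_; linked?)
open import Data.Maybe using (Maybe; just; nothing; maybe′)
open import Data.Nat using (ℕ; zero; suc; _∸_; _⊔_; _≤_; _<_; _≥_; z≤n; s≤s; s≤s⁻¹; z<s; s<s; _≟_; _≤?_; _<?_; _≥?_)
import Data.Nat as ℕ
import Data.Nat.ListAction as ℕ
import Data.Nat.Properties as ℕ
open import Data.Nat.Solver using (module +-*-Solver)
open import Data.Product using (Σ; ∃; _×_; _,_; proj₁; proj₂)
open import Data.Sum using (inj₁; inj₂)
open import Data.Vec using (Vec; []; _∷_; replicate; lookup; updateAt; toList)
import Data.Vec as Vec
import Data.Vec.Properties as Vec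
open import Function using (_∘_; id)
open import Relation.Binary.Definitions using (tri<; tri≈; tri>)
open import Relation.Binary.PropositionalEquality as ≡ using (_≡_; _≢_; module ≡-Reasoning)
import Relation.Binary.Reasoning.Setoid as SetoidReasoning
open import Relation.Nullary using (Dec; yes; no; does; ¬_)
open import Relation.Nullary.Decidable using (dec-true; dec-false; _×-dec_)
open import Relation.Unary using (Decidable)

-- The (i, j) entry of the matrix defining ŝ_μ is a power series in xᵢ alone, so the
-- coefficient of its determinant at x^β is the determinant of the coefficients at βᵢ, which
-- alternates in β.  Hence it is determined by its values at strictly decreasing exponents
-- β = ν + (N-1, …, 1, 0), and expanding in the determinants of the Schur polynomials gives
-- the coefficient det[w_j(ν_i - μ_j - i + j)] at s_ν, where w_j = h for j ≤ d and ± e for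
-- j > d.  Division by the Vandermonde product is linear and needs only finitely many
-- coefficients.  Since w_j(k) vanishes for k < 0, and for j > d also for
-- k > j - 1 - μ_j, the coefficient is zero by a zero block unless μ ⊆ ν and ν has d diagonal
-- boxes; otherwise the matrix is block diagonal with the h-block, the e-block and, below row
-- ℓ(ν), a unitriangular tail.

-- `/Vandermonde` is an operator on coefficients, not multiplication by an inverse, so nothing is
-- cancelled against the Vandermonde product; the identity is proved for the numerators and carried
-- through the division. The numerator of ŝ_μ is an infinite combination of Schur numerators. It
-- becomes finite because each division by xᵢ - xⱼ reads only coefficients exactly one degree
-- higher: the coefficient at x^α depends only on numerator coefficients of degree |α| + N(N-1)/2,
-- to which only the ν with |ν| = |α| contribute, and these are the index set of `↾`.
--
-- The determinants of coefficients are taken over lists of rows and columns instead of functions on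
-- `Fin n`. Rows can then be indexed by exponents or by natural numbers, blocks are concatenations,
-- and every argument is a recursion on the columns, without permutations.
--
-- If N < ℓ(μ), there is no numerator to compare: both sides vanish because each ν containing μ is
-- also longer than N.

-- The evidence selects k positions, so deleting one entry of the list costs at most one of them. It
-- measures the width of zero blocks whose columns need not be adjacent.
data AtLeast {C : Set} (Q : C → Set) : ℕ → List C → Set where
  none : ∀ {cs} → AtLeast Q 0 cs
  take : ∀ {k c cs} → Q c → AtLeast Q k cs → AtLeast Q (suc k) (c ∷ cs)
  skip : ∀ {k c cs} → AtLeast Q k cs → AtLeast Q k (c ∷ cs)

atLeast-pred : ∀ {C : Set} {Q : C → Set} {k cs} → AtLeast Q (suc k) cs → AtLeast Q k cs
atLeast-pred (take q qs) = skip qs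
atLeast-pred {k = zero}  (skip qs) = none
atLeast-pred {k = suc k} (skip qs) = skip (atLeast-pred qs)

atLeast-all : ∀ {C : Set} {Q : C → Set} {cs} ds → All Q cs → AtLeast Q (length cs) (cs ++ ds)
atLeast-all ds []       = none
atLeast-all ds (q ∷ qs) = take q (atLeast-all ds qs)

atLeast-prepend : ∀ {C : Set} {Q : C → Set} {k cs} bs → AtLeast Q k cs → AtLeast Q k (bs ++ cs)
atLeast-prepend []       qs = qs
atLeast-prepend (b ∷ bs) qs = skip (atLeast-prepend bs qs)

-- Determinants as iterated interior products

module Determinants (K : CommutativeRing 0ℓ 0ℓ) where

  open CommutativeRing K hiding (zero) renaming (distribˡ to *-distribˡ-+; distribʳ to *-distribʳ-+)
  open RingOperations rawRing using (_^_; sum; ∑; ∏; det)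
  open RingProperties ring
  open SetoidReasoning setoid
  private
    module + = CommutativeSemigroupProperties (CommutativeRing.+-commutativeSemigroup K)
    module * = CommutativeSemigroupProperties (CommutativeRing.*-commutativeSemigroup K)

  x-y+[y-x]≈0 : ∀ x y → (x + - y) + (y + - x) ≈ 0#
  x-y+[y-x]≈0 x y = begin
    (x + - y) + (y + - x)  ≈⟨ +.interchange x (- y) y (- x) ⟩
    (x + y) + (- y + - x)  ≈⟨ +-congˡ (-‿+-comm y x) ⟩
    (x + y) + - (y + x)    ≈⟨ +-congˡ (-‿cong (+-comm y x)) ⟩
    (x + y) + - (x + y)    ≈⟨ -‿inverseʳ _ ⟩
    0#                     ∎

  x-[y-z]≈x-y+z : ∀ x y z → x + - (y + - z) ≈ (x + - y) + z
  x-[y-z]≈x-y+z x y z = begin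
    x + - (y + - z)      ≈⟨ +-congˡ (-‿+-comm y (- z)) ⟨
    x + (- y + - - z)    ≈⟨ +-congˡ (+-congˡ (-‿involutive z)) ⟩
    x + (- y + z)        ≈⟨ +-assoc x (- y) z ⟨
    (x + - y) + z        ∎

  x-0≈x : ∀ {x y} → y ≈ 0# → x + - y ≈ x
  x-0≈x {x} {y} y≈0 = begin
    x + - y   ≈⟨ +-congˡ (-‿cong y≈0) ⟩
    x + - 0#  ≈⟨ +-congˡ -0#≈0# ⟩
    x + 0#    ≈⟨ +-identityʳ x ⟩
    x         ∎

  x*y-z≈0 : ∀ {x y z} → x * y ≈ 0# → z ≈ 0# → x * y + - z ≈ 0#
  x*y-z≈0 p q = trans (x-0≈x q) p

  x*0≈0 : ∀ {x y} → y ≈ 0# → x * y ≈ 0#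
  x*0≈0 {x} y≈0 = trans (*-congˡ y≈0) (zeroʳ x)

  0*x≈0 : ∀ {x y} → x ≈ 0# → x * y ≈ 0#
  0*x≈0 {y = y} x≈0 = trans (*-congʳ x≈0) (zeroˡ y)

  -x≈0 : ∀ {x} → x ≈ 0# → - x ≈ 0#
  -x≈0 x≈0 = trans (-‿cong x≈0) -0#≈0#

  -- `repeat` is a field of its own because 2 may be a zero divisor, and then `swap` does not imply
  -- it. Only adjacent entries occur, which is all that insertion sort uses.
  record Alternating {B : Set} (f : List B → Carrier) : Set where
    field
      swap   : ∀ xs b c ys → f (xs ++ b ∷ c ∷ ys) ≈ - f (xs ++ c ∷ b ∷ ys)
      repeat : ∀ xs b ys → f (xs ++ b ∷ b ∷ ys) ≈ 0#

  module _ {B : Set} where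
    open Alternating

    alternating-∷ : ∀ {f : List B → Carrier} b → Alternating f → Alternating (f ∘ (b ∷_))
    alternating-∷ b alt .swap   xs = swap alt (b ∷ xs)
    alternating-∷ b alt .repeat xs = repeat alt (b ∷ xs)

    alternating-+ : ∀ {f g : List B → Carrier} →
      Alternating f → Alternating g → Alternating (λ bs → f bs + g bs)
    alternating-+ F G .swap xs b c ys =
      trans (+-cong (swap F xs b c ys) (swap G xs b c ys)) (-‿+-comm _ _)
    alternating-+ F G .repeat xs b ys =
      trans (+-cong (repeat F xs b ys) (repeat G xs b ys)) (+-identityˡ 0#)

    alternating-* : ∀ {f : List B → Carrier} k → Alternating f → Alternating (λ bs → k * f bs)
    alternating-* k F .swap xs b c ys =
      trans (*-congˡ (swap F xs b c ys)) (sym (-‿distribʳ-* k _))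
    alternating-* k F .repeat xs b ys = x*0≈0 (repeat F xs b ys)

    alternating-neg : ∀ {f : List B → Carrier} → Alternating f → Alternating (λ bs → - f bs)
    alternating-neg F .swap xs b c ys = -‿cong (swap F xs b c ys)
    alternating-neg F .repeat xs b ys = -x≈0 (repeat F xs b ys)

    alternating-0 : Alternating {B} (λ _ → 0#)
    alternating-0 .swap xs b c ys = sym -0#≈0#
    alternating-0 .repeat xs b ys = refl

    alternating-∑ : ∀ {I : Set} {f : I → List B → Carrier} →
      (∀ i → Alternating (f i)) → ∀ is → Alternating (λ bs → ∑ (map (λ i → f i bs) is))
    alternating-∑ F []       = alternating-0
    alternating-∑ F (i ∷ is) = alternating-+ (F i) (alternating-∑ F is)

  sum-cong : ∀ {n} {f g : Fin n → Carrier} → (∀ i → f i ≈ g i) → sum f ≈ sum g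
  sum-cong {zero}  f≈g = refl
  sum-cong {suc n} f≈g = +-cong (f≈g zero) (sum-cong (λ i → f≈g (suc i)))

  sum-neg : ∀ {n} (f : Fin n → Carrier) → sum (λ i → - f i) ≈ - sum f
  sum-neg {zero}  f = sym -0#≈0#
  sum-neg {suc n} f = trans (+-congˡ (sum-neg (λ i → f (suc i)))) (-‿+-comm _ _)

  module _ {C : Set} where

    -- ∑ⱼ (-1)ʲ r(cⱼ) F(cs without cⱼ): the interior product with r.  In this
    -- form two interior products anticommute by induction on cs alone.
    expand : (C → Carrier) → (List C → Carrier) → List C → Carrier
    expand r F []       = 0#
    expand r F (c ∷ cs) = r c * F cs + - expand r (λ cs′ → F (c ∷ cs′)) cs

    -- Laplace expansion along the first row. If the lists differ in length the value is 0, which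
    -- lets the alternation, scaling and zero-block lemmas do without a length hypothesis.
    Det : List (C → Carrier) → List C → Carrier
    Det []       []       = 1#
    Det []       (_ ∷ _)  = 0#
    Det (r ∷ rs) cs       = expand r (Det rs) cs

    expand-cong : ∀ {Q : C → Set} {r r′ F G cs} → All Q cs →
      (∀ {c} → Q c → r c ≈ r′ c) → (∀ {ds} → All Q ds → F ds ≈ G ds) →
      expand r F cs ≈ expand r′ G cs
    expand-cong []       r≈ F≈ = refl
    expand-cong (q ∷ qs) r≈ F≈ =
      +-cong (*-cong (r≈ q) (F≈ qs)) (-‿cong (expand-cong qs r≈ (λ qs′ → F≈ (q ∷ qs′))))

    expand-congᶠ : ∀ {r F G} → (∀ ds → F ds ≈ G ds) → ∀ cs → expand r F cs ≈ expand r G cs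
    expand-congᶠ F≈ []       = refl
    expand-congᶠ F≈ (c ∷ cs) =
      +-cong (*-congˡ (F≈ cs)) (-‿cong (expand-congᶠ (λ ds → F≈ (c ∷ ds)) cs))

    Det-cong : ∀ {Q : C → Set} {rs rs′ cs} → All Q cs →
      Pointwise (λ r r′ → ∀ {c} → Q c → r c ≈ r′ c) rs rs′ → Det rs cs ≈ Det rs′ cs
    Det-cong []       []        = refl
    Det-cong (q ∷ qs) []        = refl
    Det-cong qs       (r≈ ∷ rs≈) = expand-cong qs r≈ (λ qs′ → Det-cong qs′ rs≈)

    expand-0 : ∀ {r F} → (∀ ds → F ds ≈ 0#) → ∀ cs → expand r F cs ≈ 0#
    expand-0 F≈0 []       = refl
    expand-0 F≈0 (c ∷ cs) = x*y-z≈0 (x*0≈0 (F≈0 cs)) (expand-0 (λ ds → F≈0 (c ∷ ds)) cs)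

    -- The shape `k * F ds + - G ds` is that of `expand r′ F (c ∷ ds)` as a function of `ds`, with k
    -- = r′ c.
    expand-linear : ∀ k r F G cs →
      expand r (λ ds → k * F ds + - G ds) cs ≈ k * expand r F cs + - expand r G cs
    expand-linear k r F G [] = sym (x*y-z≈0 (zeroʳ k) refl)
    expand-linear k r F G (c ∷ cs) = begin
      r c * (k * F cs + - G cs) + - expand r (λ ds → k * F (c ∷ ds) + - G (c ∷ ds)) cs
        ≈⟨ +-cong (*-distribˡ-+ _ _ _) (-‿cong (expand-linear k r _ _ cs)) ⟩
      (r c * (k * F cs) + r c * - G cs) + - (k * F′ + - G′)
        ≈⟨ +-cong (+-cong (*.x∙yz≈y∙xz _ _ _) (sym (-‿distribʳ-* _ _))) (sym (-‿+-comm _ _)) ⟩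
      (k * (r c * F cs) + - (r c * G cs)) + (- (k * F′) + - - G′)
        ≈⟨ +.interchange _ _ _ _ ⟩
      (k * (r c * F cs) + - (k * F′)) + (- (r c * G cs) + - - G′)
        ≈⟨ +-cong (+-congˡ (-‿distribʳ-* _ _)) (-‿+-comm _ _) ⟩
      (k * (r c * F cs) + k * - F′) + - (r c * G cs + - G′)
        ≈⟨ +-congʳ (*-distribˡ-+ _ _ _) ⟨
      k * (r c * F cs + - F′) + - (r c * G cs + - G′) ∎
      where
      F′ = expand r (λ ds → F (c ∷ ds)) cs
      G′ = expand r (λ ds → G (c ∷ ds)) cs

    expand-neg : ∀ r F cs → expand r (λ ds → - F ds) cs ≈ - expand r F cs
    expand-neg r F []       = sym -0#≈0#
    expand-neg r F (c ∷ cs) = begin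
      r c * - F cs + - expand r (λ ds → - F (c ∷ ds)) cs
        ≈⟨ +-cong (sym (-‿distribʳ-* _ _)) (-‿cong (expand-neg r _ cs)) ⟩
      - (r c * F cs) + - - expand r (λ ds → F (c ∷ ds)) cs  ≈⟨ -‿+-comm _ _ ⟩
      - expand r F (c ∷ cs) ∎

    -- The bracket collects the terms that delete column c and is antisymmetric in r and r′. The
    -- remainder is again a double expansion, with c kept, which sets up the inductions for
    -- anticommutation and for the square.
    expand-expand : ∀ r r′ F c cs → expand r (expand r′ F) (c ∷ cs) ≈
      (r c * expand r′ F cs + - (r′ c * expand r F cs)) +
      expand r (expand r′ (λ ds → F (c ∷ ds))) cs
    expand-expand r r′ F c cs = trans
      (+-congˡ (-‿cong (expand-linear (r′ c) r F _ cs)))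
      (x-[y-z]≈x-y+z _ _ _)

    expand-anticommute : ∀ r r′ F cs →
      expand r (expand r′ F) cs + expand r′ (expand r F) cs ≈ 0#
    expand-anticommute r r′ F []       = +-identityˡ 0#
    expand-anticommute r r′ F (c ∷ cs) = begin
      expand r (expand r′ F) (c ∷ cs) + expand r′ (expand r F) (c ∷ cs)
        ≈⟨ +-cong (expand-expand r r′ F c cs) (expand-expand r′ r F c cs) ⟩
      ((_ + - _) + _) + ((_ + - _) + _)
        ≈⟨ +.interchange _ _ _ _ ⟩
      ((_ + - _) + (_ + - _)) + (_ + _)
        ≈⟨ +-cong (x-y+[y-x]≈0 _ _) (expand-anticommute r r′ _ cs) ⟩
      0# + 0#
        ≈⟨ +-identityˡ 0# ⟩
      0# ∎

    expand-square : ∀ r F cs → expand r (expand r F) cs ≈ 0#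
    expand-square r F []       = refl
    expand-square r F (c ∷ cs) = begin
      expand r (expand r F) (c ∷ cs)  ≈⟨ expand-expand r r F c cs ⟩
      (_ + - _) + _                   ≈⟨ +-cong (-‿inverseʳ _) (expand-square r _ cs) ⟩
      0# + 0#                         ≈⟨ +-identityˡ 0# ⟩
      0#                              ∎

    Det-alternating : ∀ {B : Set} (row : B → C → Carrier) cs →
      Alternating (λ bs → Det (map row bs) cs)
    Det-alternating row cs = record { swap = λ xs b c ys → sw xs b c ys cs ; repeat = λ xs b ys → rp xs b ys cs }
      where
      sw : ∀ xs b c ys cs → Det (map row (xs ++ b ∷ c ∷ ys)) cs ≈ - Det (map row (xs ++ c ∷ b ∷ ys)) cs
      sw []       b c ys cs = +-inverseˡ-unique _ _ (expand-anticommute _ _ _ cs)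
      sw (x ∷ xs) b c ys cs =
        trans (expand-congᶠ (sw xs b c ys) cs) (expand-neg (row x) _ cs)
      rp : ∀ xs b ys cs → Det (map row (xs ++ b ∷ b ∷ ys)) cs ≈ 0#
      rp []       b ys cs = expand-square _ _ cs
      rp (x ∷ xs) b ys cs = expand-0 (rp xs b ys) cs

    -- Deleting a selected column brings the factor r c = 0; deleting any other column leaves all
    -- selected ones in place, so F vanishes.
    expand-vanish : ∀ {Q : C → Set} {r F k cs} → (∀ {c} → Q c → r c ≈ 0#) →
      AtLeast Q (suc k) cs → (∀ {ds} → AtLeast Q (suc k) ds → F ds ≈ 0#) → expand r F cs ≈ 0#
    expand-vanish {k = zero} r≈0 (take {cs = cs} q qs) F≈0 =
      x*y-z≈0 (0*x≈0 (r≈0 q)) (expand-0 (λ ds → F≈0 (take q none)) cs)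
    expand-vanish {k = suc k} r≈0 (take q qs) F≈0 =
      x*y-z≈0 (0*x≈0 (r≈0 q)) (expand-vanish r≈0 qs (λ qs′ → F≈0 (take q qs′)))
    expand-vanish r≈0 (skip qs) F≈0 =
      x*y-z≈0 (x*0≈0 (F≈0 qs)) (expand-vanish r≈0 qs (λ qs′ → F≈0 (skip qs′)))

    -- Nothing is known about r here: the deleted column may be a selected one, so F must already
    -- vanish with one selected column fewer.
    expand-drop : ∀ {Q : C → Set} {r F k cs} →
      AtLeast Q (suc k) cs → (∀ {ds} → AtLeast Q k ds → F ds ≈ 0#) → expand r F cs ≈ 0#
    expand-drop {k = zero} {cs = cs} qs F≈0 = expand-0 (λ ds → F≈0 none) cs
    expand-drop {k = suc k} (take q qs) F≈0 =
      x*y-z≈0 (x*0≈0 (F≈0 qs)) (expand-drop qs (λ qs′ → F≈0 (take q qs′)))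
    expand-drop {k = suc k} (skip qs) F≈0 =
      x*y-z≈0 (x*0≈0 (F≈0 (atLeast-pred qs))) (expand-drop qs (λ qs′ → F≈0 (skip qs′)))

    Vanishing : (C → Set) → (C → Carrier) → Set
    Vanishing Q r = ∀ {c} → Q c → r c ≈ 0#

    -- The easy half of the Frobenius–König theorem.
    Det-vanish : ∀ {Q : C → Set} rs {ss cs} → All (Vanishing Q) ss →
      AtLeast Q (suc (length rs)) cs → Det (rs ++ ss) cs ≈ 0#
    Det-vanish (r ∷ rs) ss qs = expand-drop qs (Det-vanish rs ss)
    Det-vanish []       (s ∷ ss) qs = expand-vanish s qs (Det-vanish [] ss)
    Det-vanish []       []       (take q qs) = refl
    Det-vanish []       []       (skip qs) = refl

    -- The vanishing rows come first and can only delete columns outside the selection, so the count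
    -- survives until `ss` alone remains, with more columns than rows.
    Det-vanish′ : ∀ {Q : C → Set} {rs} ss {cs} → All (Vanishing Q) rs →
      AtLeast Q (suc (length ss)) cs → Det (rs ++ ss) cs ≈ 0#
    Det-vanish′ ss [] qs = ≡.subst (λ l → Det l _ ≈ 0#) (++-identityʳ ss) (Det-vanish ss [] qs)
    Det-vanish′ ss (r ∷ rs) qs = expand-vanish r qs (Det-vanish′ ss rs)

    expand-kill : ∀ {r cs} F → All (λ c → r c ≈ 0#) cs → expand r F cs ≈ 0#
    expand-kill F []       = refl
    expand-kill F (p ∷ ps) = x*y-z≈0 (0*x≈0 p) (expand-kill _ ps)

    -- Only deletions within `cs` contribute. The hypothesis on F is limited to lists one shorter
    -- than `cs`, since those are the ones for which the remaining first block is square.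
    expand-lower : ∀ {r F G k} cs {ds} → All (λ c → r c ≈ 0#) ds →
      (∀ {cs′} → suc (length cs′) ≡ length cs → F (cs′ ++ ds) ≈ G cs′ * k) →
      expand r F (cs ++ ds) ≈ expand r G cs * k
    expand-lower []       r≈0 F≈ = trans (expand-kill _ r≈0) (sym (zeroˡ _))
    expand-lower {r} {F} {G} {k} (c ∷ cs) {ds} r≈0 F≈ = begin
      r c * F (cs ++ ds) + - expand r _ (cs ++ ds)
        ≈⟨ +-cong (*-congˡ (F≈ ≡.refl)) (-‿cong (expand-lower cs r≈0 (λ p → F≈ (≡.cong suc p)))) ⟩
      r c * (G cs * k) + - (expand r _ cs * k)
        ≈⟨ +-cong (sym (*-assoc _ _ _)) (-‿distribˡ-* _ _) ⟩
      (r c * G cs) * k + (- expand r _ cs) * k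
        ≈⟨ *-distribʳ-+ _ _ _ ⟨
      (r c * G cs + - expand r _ cs) * k ∎

    Det-lower : ∀ rs ss cs ds → length rs ≡ length cs →
      All (λ r → All (λ c → r c ≈ 0#) ds) rs →
      Det (rs ++ ss) (cs ++ ds) ≈ Det rs cs * Det ss ds
    Det-lower []       ss []       ds eq []        = sym (*-identityˡ _)
    Det-lower (r ∷ rs) ss cs       ds eq (p ∷ ps) =
      expand-lower cs p (λ {cs′} eq′ →
        Det-lower rs ss cs′ ds (ℕ.suc-injective (≡.trans eq (≡.sym eq′))) ps)

    -- Here r may be nonzero on `ds`. Deleting a column of `ds` keeps all of `cs`, and the first
    -- hypothesis on F removes these terms.
    expand-upper : ∀ {Q : C → Set} {r F G k} cs {ds} → All Q cs →
      (∀ es → F (cs ++ es) ≈ 0#) →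
      (∀ {cs′} → All Q cs′ → suc (length cs′) ≡ length cs → F (cs′ ++ ds) ≈ G cs′ * k) →
      expand r F (cs ++ ds) ≈ expand r G cs * k
    expand-upper []       {ds} qs F≈0 F≈ = trans (expand-0 F≈0 ds) (sym (zeroˡ _))
    expand-upper {Q} {r} {F} {G} {k} (c ∷ cs) {ds} (q ∷ qs) F≈0 F≈ = begin
      r c * F (cs ++ ds) + - expand r _ (cs ++ ds)
        ≈⟨ +-cong (*-congˡ (F≈ qs ≡.refl))
             (-‿cong (expand-upper {Q} cs qs (λ es → F≈0 es) (λ qs′ p → F≈ (q ∷ qs′) (≡.cong suc p)))) ⟩
      r c * (G cs * k) + - (expand r _ cs * k)
        ≈⟨ +-cong (sym (*-assoc _ _ _)) (-‿distribˡ-* _ _) ⟩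
      (r c * G cs) * k + (- expand r _ cs) * k
        ≈⟨ *-distribʳ-+ _ _ _ ⟨
      (r c * G cs + - expand r _ cs) * k ∎

    Det-upper : ∀ {Q : C → Set} rs ss {cs} ds → length rs ≡ length cs →
      All Q cs → All (Vanishing Q) ss →
      Det (rs ++ ss) (cs ++ ds) ≈ Det rs cs * Det ss ds
    Det-upper []       ss ds eq [] vs = sym (*-identityˡ _)
    Det-upper {Q} (r ∷ rs) ss {cs} ds eq qs vs =
      expand-upper cs qs
        -- The row r is used up but all of `cs` is left, one column more than `rs` can match, so the
        -- zero block under `cs` is too wide.
        (λ es → Det-vanish rs vs (≡.subst (λ n → AtLeast Q n (cs ++ es)) (≡.sym eq) (atLeast-all es qs)))
        (λ qs′ eq′ → Det-upper rs ss ds (ℕ.suc-injective (≡.trans eq (≡.sym eq′))) qs′ vs)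

    expand-scale : ∀ {r r′ : C → Carrier} {F F′} ρ σ (κ : C → Carrier) cs →
      (∀ c → r′ c ≈ ρ * (r c * κ c)) → (∀ ds → F′ ds ≈ σ * (F ds * ∏ (map κ ds))) →
      expand r′ F′ cs ≈ (ρ * σ) * (expand r F cs * ∏ (map κ cs))
    expand-scale ρ σ κ [] r≈ F≈ = sym (x*0≈0 (zeroˡ _))
    expand-scale {r} {r′} {F} {F′} ρ σ κ (c ∷ cs) r≈ F≈ = begin
      r′ c * F′ cs + - expand r′ (λ ds → F′ (c ∷ ds)) cs
        ≈⟨ +-cong (*-cong (r≈ c) (F≈ cs)) (-‿cong (expand-scale ρ (σ * κ c) κ cs r≈ F∷≈)) ⟩
      (ρ * (r c * κ c)) * (σ * (F cs * κs)) + - ((ρ * (σ * κ c)) * (E * κs))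
        ≈⟨ +-cong (*.interchange _ _ _ _) (-‿cong (trans (*-congʳ (sym (*-assoc _ _ _))) (*-assoc _ _ _))) ⟩
      (ρ * σ) * ((r c * κ c) * (F cs * κs)) + - ((ρ * σ) * (κ c * (E * κs)))
        ≈⟨ +-cong (*-congˡ (*.interchange _ _ _ _)) (-‿cong (*-congˡ (*.x∙yz≈y∙xz _ _ _))) ⟩
      (ρ * σ) * ((r c * F cs) * (κ c * κs)) + - ((ρ * σ) * (E * (κ c * κs)))
        ≈⟨ +-congˡ (trans (-‿distribʳ-* _ _) (*-congˡ (-‿distribˡ-* _ _))) ⟩
      (ρ * σ) * ((r c * F cs) * (κ c * κs)) + (ρ * σ) * (- E * (κ c * κs))
        ≈⟨ *-distribˡ-+ _ _ _ ⟨
      (ρ * σ) * ((r c * F cs) * (κ c * κs) + - E * (κ c * κs))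
        ≈⟨ *-congˡ (*-distribʳ-+ _ _ _) ⟨
      (ρ * σ) * ((r c * F cs + - E) * (κ c * κs)) ∎
      where
      κs = ∏ (map κ cs)
      E  = expand r (λ ds → F (c ∷ ds)) cs
      -- Column c stays in the list, so its factor moves out of the product into the constant σ.
      F∷≈ : ∀ ds → F′ (c ∷ ds) ≈ (σ * κ c) * (F (c ∷ ds) * ∏ (map κ ds))
      F∷≈ ds = begin
        F′ (c ∷ ds)                                   ≈⟨ F≈ (c ∷ ds) ⟩
        σ * (F (c ∷ ds) * (κ c * ∏ (map κ ds)))       ≈⟨ *-congˡ (*.x∙yz≈y∙xz _ _ _) ⟩
        σ * (κ c * (F (c ∷ ds) * ∏ (map κ ds)))       ≈⟨ *-assoc _ _ _ ⟨
        (σ * κ c) * (F (c ∷ ds) * ∏ (map κ ds))       ∎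

    Det-scale : ∀ {B : Set} (row row′ : B → C → Carrier) (ρ : B → Carrier) (κ : C → Carrier) →
      (∀ b c → row′ b c ≈ ρ b * (row b c * κ c)) → ∀ bs cs →
      Det (map row′ bs) cs ≈ ∏ (map ρ bs) * (Det (map row bs) cs * ∏ (map κ cs))
    Det-scale row row′ ρ κ row≈ [] []       = sym (trans (*-identityˡ _) (*-identityˡ _))
    Det-scale row row′ ρ κ row≈ [] (c ∷ cs) = sym (x*0≈0 (zeroˡ _))
    Det-scale row row′ ρ κ row≈ (b ∷ bs) cs =
      expand-scale (ρ b) (∏ (map ρ bs)) κ cs (row≈ b) (Det-scale row row′ ρ κ row≈ bs)

    Det-∷ : ∀ {r rs c cs} → r c ≈ 1# → All (λ s → s c ≈ 0#) rs → Det (r ∷ rs) (c ∷ cs) ≈ Det rs cs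
    Det-∷ {r} {rs} {c} {cs} r≈1 rs≈0 = begin
      r c * Det rs cs + - expand r (λ ds → Det rs (c ∷ ds)) cs
        -- Every other minor keeps column c, which is zero in all rows of `rs`.
        ≈⟨ x-0≈x (expand-0 (λ ds → Det-vanish {Q = _≡ c} [] (vanishing rs≈0) (take ≡.refl none)) cs) ⟩
      r c * Det rs cs  ≈⟨ *-congʳ r≈1 ⟩
      1# * Det rs cs   ≈⟨ *-identityˡ _ ⟩
      Det rs cs        ∎
      where
      vanishing : ∀ {ss} → All (λ s → s c ≈ 0#) ss → All (Vanishing (_≡ c)) ss
      vanishing []       = []
      vanishing (p ∷ ps) = (λ { ≡.refl → p }) ∷ vanishing ps

    -- The signs come from the nested subtractions of `expand`: each column passed over contributes
    -- one factor -1, which `negate` extracts from the tail of the sum.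
    sum-expand : ∀ {n} r F (c : Fin (suc n) → C) →
      sum (λ j → (- 1#) ^ toℕ j * r (c j) * F (tabulate (c ∘ punchIn j))) ≈ expand r F (tabulate c)
    sum-expand {n} r F c = +-cong (*-congʳ (*-identityˡ _)) (rest n c)
      where
      rest : ∀ n (c : Fin (suc n) → C) →
        sum (λ j → (- 1#) ^ toℕ (suc j) * r (c (suc j)) * F (tabulate (c ∘ punchIn (suc j)))) ≈
        - expand r (λ ds → F (c zero ∷ ds)) (tabulate (c ∘ suc))
      rest zero    c = sym -0#≈0#
      rest (suc n) c = begin
        sum (λ j → (- 1#) ^ toℕ (suc j) * r (c (suc j)) * F (tabulate (c ∘ punchIn (suc j))))
          ≈⟨ sum-cong negate ⟩
        sum (λ j → - term j)
          ≈⟨ sum-neg term ⟩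
        - sum term
          ≈⟨ -‿cong (sum-expand r (λ ds → F (c zero ∷ ds)) (c ∘ suc)) ⟩
        - expand r (λ ds → F (c zero ∷ ds)) (tabulate (c ∘ suc)) ∎
        where
        term : Fin (suc n) → Carrier
        term j = (- 1#) ^ toℕ j * r (c (suc j)) * F (tabulate (c ∘ punchIn (suc j)))
        negate : ∀ j → (- 1#) ^ toℕ (suc j) * r (c (suc j)) * F (tabulate (c ∘ punchIn (suc j))) ≈ - term j
        negate j = begin
          (- 1# * (- 1#) ^ toℕ j) * r (c (suc j)) * F (tabulate (c ∘ punchIn (suc j)))
            ≈⟨ *-congʳ (*-congʳ (-1*x≈-x _)) ⟩
          (- (- 1#) ^ toℕ j) * r (c (suc j)) * F (tabulate (c ∘ punchIn (suc j)))
            ≈⟨ *-congʳ (-‿distribˡ-* _ _) ⟨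
          (- ((- 1#) ^ toℕ j * r (c (suc j)))) * F (tabulate (c ∘ punchIn (suc j)))
            ≈⟨ -‿distribˡ-* _ _ ⟨
          - term j ∎

    det≈Det : ∀ {n} (row : Fin n → C → Carrier) (col : Fin n → C) →
      det (λ i j → row i (col j)) ≈ Det (tabulate row) (tabulate col)
    det≈Det {zero}  row col = refl
    det≈Det {suc n} row col = trans
      (sum-cong (λ j → *-congˡ {(- 1#) ^ toℕ j * row zero (col j)} (det≈Det (row ∘ suc) (col ∘ punchIn j))))
      (sum-expand (row zero) (Det (tabulate (row ∘ suc))) col)

-- Alternating functions and strictly decreasing lists

data Descending : ℕ → List ℕ → Set where
  []  : ∀ {m} → Descending m []
  _∷_ : ∀ {m b bs} → b < m → Descending b bs → Descending m (b ∷ bs)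

descending-weaken : ∀ {m n bs} → m ≤ n → Descending m bs → Descending n bs
descending-weaken m≤n []        = []
descending-weaken m≤n (b<m ∷ d) = ℕ.<-≤-trans b<m m≤n ∷ d

descending-bound : ∀ {m bs} → Descending m bs → All (_< m) bs
descending-bound []        = []
descending-bound (b<m ∷ d) = b<m ∷ All.map (λ c<b → ℕ.<-trans c<b b<m) (descending-bound d)

-- Side conditions such as a fixed length and a fixed sum have to survive the sorting of the list.
SwapClosed : (List ℕ → Set) → Set
SwapClosed T = ∀ xs b c ys → T (xs ++ b ∷ c ∷ ys) → T (xs ++ c ∷ b ∷ ys)

module Sorting (K : CommutativeRing 0ℓ 0ℓ) where

  open CommutativeRing K hiding (zero)
  open Determinants K
  open Alternating

  -- One insertion of insertion sort. An equal neighbour gives 0 by `repeat`; a larger one is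
  -- swapped to the front and kept there while b moves on into the tail.
  alternating-insert : ∀ {f m b bs} (T : List ℕ → Set) → SwapClosed T → Alternating f →
    (∀ {cs} → Descending m cs → T cs → f cs ≈ 0#) →
    b < m → Descending m bs → T (b ∷ bs) → f (b ∷ bs) ≈ 0#
  alternating-insert T closed alt f≈0 b<m [] t = f≈0 (b<m ∷ []) t
  alternating-insert {b = b} T closed alt f≈0 b<m (_∷_ {b = c} {bs} c<m d) t with ℕ.<-cmp b c
  ... | tri> _ _ c<b      = f≈0 (b<m ∷ c<b ∷ d) t
  ... | tri≈ _ ≡.refl _   = repeat alt [] b bs
  ... | tri< b<c _ _      = trans (swap alt [] b c bs) (-x≈0
    (alternating-insert (T ∘ (c ∷_)) (closed ∘ (c ∷_)) (alternating-∷ c alt)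
      (λ d′ → f≈0 (c<m ∷ d′)) b<c d (closed [] b c bs t)))

  -- Insertion sort: the tail is sorted by the recursive call, with b held in front, and then b is
  -- inserted.
  alternating-vanish : ∀ {f} (T : List ℕ → Set) → SwapClosed T → Alternating f →
    (∀ {m bs} → Descending m bs → T bs → f bs ≈ 0#) → ∀ bs → T bs → f bs ≈ 0#
  alternating-vanish T closed alt f≈0 []       t = f≈0 {0} [] t
  alternating-vanish T closed alt f≈0 (b ∷ bs) t =
    alternating-vanish (T ∘ (b ∷_)) (closed ∘ (b ∷_)) (alternating-∷ b alt)
      -- The bound has to exceed both b and the sorted tail, since either may supply the head after
      -- the insertion.
      (λ {m} d → alternating-insert {m = suc b ⊔ m} T closed alt f≈0
        (ℕ.m≤m⊔n (suc b) m) (descending-weaken (ℕ.m≤n⊔m (suc b) m) d))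
      bs t

  -- The Kronecker delta; `δ m` is at the same time the coefficient sequence of the power x^m.
  δ : ℕ → ℕ → Carrier
  δ zero    zero    = 1#
  δ zero    (suc c) = 0#
  δ (suc b) zero    = 0#
  δ (suc b) (suc c) = δ b c

  δ-diagonal : ∀ b → δ b b ≈ 1#
  δ-diagonal zero    = refl
  δ-diagonal (suc b) = δ-diagonal b

  δ-≢ : ∀ b c → b ≢ c → δ b c ≈ 0#
  δ-≢ zero    zero    b≢c = ⊥-elim (b≢c ≡.refl)
  δ-≢ zero    (suc c) b≢c = refl
  δ-≢ (suc b) zero    b≢c = refl
  δ-≢ (suc b) (suc c) b≢c = δ-≢ b c (b≢c ∘ ≡.cong suc)

  Det-δ-≡ : ∀ {m bs} → Descending m bs → Det (map δ bs) bs ≈ 1#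
  Det-δ-≡ [] = refl
  Det-δ-≡ (_∷_ {b = b} b<m d) = trans
    (Det-∷ (δ-diagonal b) (All.map⁺ (All.map (λ {c} c<b → δ-≢ c b (ℕ.<⇒≢ c<b)) (descending-bound d))))
    (Det-δ-≡ d)

  -- At the first difference the larger of the two entries occurs nowhere in the rest of the other
  -- list, which produces a zero row or a zero column.
  Det-δ-≢ : ∀ {m n bs cs} → Descending m bs → Descending n cs → bs ≢ cs → Det (map δ bs) cs ≈ 0#
  Det-δ-≢ []       []       bs≢cs = ⊥-elim (bs≢cs ≡.refl)
  Det-δ-≢ []       (_ ∷ _)  bs≢cs = refl
  Det-δ-≢ (_ ∷ _)  []       bs≢cs = refl
  Det-δ-≢ (_∷_ {b = b} {bs} b<m d) (_∷_ {b = c} {cs} c<n e) bs≢cs with ℕ.<-cmp b c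
  ... | tri> _ _ c<b    = expand-kill (Det (map δ bs)) (All.map (λ {x} x<b → δ-≢ b x (ℕ.<⇒≢ x<b ∘ ≡.sym))
                            (c<b ∷ All.map (λ x<c → ℕ.<-trans x<c c<b) (descending-bound e)))
  ... | tri≈ _ ≡.refl _ = trans
    (Det-∷ (δ-diagonal b) (All.map⁺ (All.map (λ {c} c<b → δ-≢ c b (ℕ.<⇒≢ c<b)) (descending-bound d))))
    (Det-δ-≢ d e (bs≢cs ∘ ≡.cong (b ∷_)))
  ... | tri< b<c _ _    = Det-vanish {Q = _≡ c} []
    (All.map⁺ (All.map (λ {x} x<c → λ { ≡.refl → δ-≢ x c (ℕ.<⇒≢ x<c) })
      (b<c ∷ All.map (λ x<b → ℕ.<-trans x<b b<c) (descending-bound d))))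
    (take ≡.refl none)

tabulate-lookup : ∀ {C : Set} {N} (f : ℕ → C) (α : Vec ℕ N) →
  tabulate (λ i → f (lookup α i)) ≡ map f (toList α)
tabulate-lookup f []      = ≡.refl
tabulate-lookup f (k ∷ α) = ≡.cong (f k ∷_) (tabulate-lookup f α)

-- Finite sums over lists

module Sums (K : CommutativeRing 0ℓ 0ℓ) where

  open CommutativeRing K hiding (zero) renaming (distribˡ to *-distribˡ-+; distribʳ to *-distribʳ-+)
  open RingOperations rawRing using (∑)
  open SetoidReasoning setoid
  private
    module + = CommutativeSemigroupProperties (CommutativeRing.+-commutativeSemigroup K)

  ∑-cong : ∀ {I : Set} {f g : I → Carrier} → (∀ i → f i ≈ g i) → ∀ is →
    ∑ (map f is) ≈ ∑ (map g is)
  ∑-cong f≈g []       = refl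
  ∑-cong f≈g (i ∷ is) = +-cong (f≈g i) (∑-cong f≈g is)

  ∑-0 : ∀ {I : Set} {f : I → Carrier} → (∀ i → f i ≈ 0#) → ∀ is → ∑ (map f is) ≈ 0#
  ∑-0 f≈0 []       = refl
  ∑-0 f≈0 (i ∷ is) = trans (+-cong (f≈0 i) (∑-0 f≈0 is)) (+-identityˡ 0#)

  ∑-++ : ∀ xs ys → ∑ (xs ++ ys) ≈ ∑ xs + ∑ ys
  ∑-++ []       ys = sym (+-identityˡ _)
  ∑-++ (x ∷ xs) ys = trans (+-congˡ (∑-++ xs ys)) (sym (+-assoc _ _ _))

  ∑-map-++ : ∀ {I : Set} (f : I → Carrier) is js →
    ∑ (map f (is ++ js)) ≈ ∑ (map f is) + ∑ (map f js)
  ∑-map-++ f is js = trans (reflexive (≡.cong ∑ (map-++ f is js))) (∑-++ (map f is) (map f js))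

  ∑-*ˡ : ∀ {I : Set} k (f : I → Carrier) is → ∑ (map (λ i → k * f i) is) ≈ k * ∑ (map f is)
  ∑-*ˡ k f []       = sym (zeroʳ k)
  ∑-*ˡ k f (i ∷ is) = trans (+-congˡ (∑-*ˡ k f is)) (sym (*-distribˡ-+ _ _ _))

  ∑-+ : ∀ {I : Set} (f g : I → Carrier) is →
    ∑ (map (λ i → f i + g i) is) ≈ ∑ (map f is) + ∑ (map g is)
  ∑-+ f g []       = sym (+-identityˡ 0#)
  ∑-+ f g (i ∷ is) = trans (+-congˡ (∑-+ f g is)) (+.interchange _ _ _ _)

  ∑-cartesianProductWith : ∀ {I J H : Set} (φ : H → Carrier) (f : I → J → H) is js →
    ∑ (map φ (cartesianProductWith f is js)) ≈ ∑ (map (λ i → ∑ (map (λ j → φ (f i j)) js)) is)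
  ∑-cartesianProductWith φ f []       js = refl
  ∑-cartesianProductWith φ f (i ∷ is) js = trans
    (∑-map-++ φ (map (f i) js) _)
    (+-cong (reflexive (≡.cong ∑ (≡.sym (map-∘ js)))) (∑-cartesianProductWith φ f is js))

  ∑-upTo : ∀ f n → ∑ (map f (upTo n)) ≡ ∑ (applyUpTo f n)
  ∑-upTo f n = ≡.cong ∑ (map-applyUpTo id f n)

  ∑-applyUpTo-cong : ∀ {f g : ℕ → Carrier} → (∀ i → f i ≈ g i) → ∀ n →
    ∑ (applyUpTo f n) ≈ ∑ (applyUpTo g n)
  ∑-applyUpTo-cong f≈g zero    = refl
  ∑-applyUpTo-cong f≈g (suc n) = +-cong (f≈g 0) (∑-applyUpTo-cong (f≈g ∘ suc) n)

  ∑-applyUpTo-0 : ∀ {f : ℕ → Carrier} → (∀ i → f i ≈ 0#) → ∀ n → ∑ (applyUpTo f n) ≈ 0#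
  ∑-applyUpTo-0 f≈0 zero    = refl
  ∑-applyUpTo-0 f≈0 (suc n) = trans (+-cong (f≈0 0) (∑-applyUpTo-0 (f≈0 ∘ suc) n)) (+-identityˡ 0#)

  if-cong : ∀ b {x y z w} → x ≈ y → z ≈ w → (if b then x else z) ≈ (if b then y else w)
  if-cong true  x≈y z≈w = x≈y
  if-cong false x≈y z≈w = z≈w

  if-zero : ∀ b {x} → x ≈ 0# → (if b then x else 0#) ≈ 0#
  if-zero true  x≈0 = x≈0
  if-zero false x≈0 = refl

-- Coefficients of power series and of their determinants

module SeriesProperties (K : CommutativeRing 0ℓ 0ℓ) where

  open CommutativeRing K hiding (zero) renaming (distribˡ to *-distribˡ-+; distribʳ to *-distribʳ-+)
  open RingOperations rawRing using (_^_; sum; ∑; ∏; det; h; e)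
  open RingProperties ring
  open Determinants K
  open Sorting K using (δ)
  open Sums K
  open SetoidReasoning setoid
  private
    module * = CommutativeSemigroupProperties (CommutativeRing.*-commutativeSemigroup K)
    module PS (N : ℕ) = PowerSeries rawRing N

  -- The Cauchy product, by recursion on the first sequence so that inductive proofs meet no
  -- truncated subtraction.
  convolution : (ℕ → Carrier) → (ℕ → Carrier) → ℕ → Carrier
  convolution u v zero    = u 0 * v 0
  convolution u v (suc k) = u 0 * v (suc k) + convolution (u ∘ suc) v k

  ∑≈convolution : ∀ u v k → ∑ (applyUpTo (λ i → u i * v (k ∸ i)) (suc k)) ≈ convolution u v k
  ∑≈convolution u v zero    = +-identityʳ _
  ∑≈convolution u v (suc k) = +-congˡ (∑≈convolution (u ∘ suc) v k)

  convolution-scale : ∀ c u v k → convolution (λ i → c * u i) v k ≈ c * convolution u v k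
  convolution-scale c u v zero    = *-assoc _ _ _
  convolution-scale c u v (suc k) = trans
    (+-cong (*-assoc _ _ _) (convolution-scale c (u ∘ suc) v k)) (sym (*-distribˡ-+ _ _ _))

  convolution-0 : ∀ {u} v → (∀ k → u k ≈ 0#) → ∀ k → convolution u v k ≈ 0#
  convolution-0 v u≈0 zero    = 0*x≈0 (u≈0 0)
  convolution-0 v u≈0 (suc k) = trans
    (+-cong (0*x≈0 (u≈0 0)) (convolution-0 v (u≈0 ∘ suc) k)) (+-identityˡ 0#)

  convolution-point : ∀ {u} v → (∀ k → u (suc k) ≈ 0#) → ∀ k → convolution u v k ≈ u 0 * v k
  convolution-point v u≈0 zero    = refl
  convolution-point v u≈0 (suc k) = trans (+-congˡ (convolution-0 v u≈0 k)) (+-identityʳ _)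

  shift : ℕ → (ℕ → Carrier) → ℕ → Carrier
  shift zero    u k       = u k
  shift (suc m) u zero    = 0#
  shift (suc m) u (suc k) = shift m u k

  convolution-δ : ∀ m v k → convolution (δ m) v k ≈ shift m v k
  convolution-δ zero    v k       = trans (convolution-point v (λ _ → refl) k) (*-identityˡ _)
  convolution-δ (suc m) v zero    = zeroˡ _
  convolution-δ (suc m) v (suc k) = trans (+-cong (zeroˡ _) (convolution-δ m v k)) (+-identityˡ _)

  h-∷ : ∀ k y ys → h (+ suc k) (y ∷ ys) ≈ y * h (+ k) (y ∷ ys) + h (+ suc k) ys
  h-∷ k y ys = trans (∑-map-++ ∏ (map (y ∷_) (multisets k (y ∷ ys))) _)
    (+-congʳ (trans (reflexive (≡.cong ∑ (≡.sym (map-∘ (multisets k (y ∷ ys))))))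
                    (∑-*ˡ y ∏ (multisets k (y ∷ ys)))))

  e-∷ : ∀ k y ys → e (+ suc k) (y ∷ ys) ≈ y * e (+ k) ys + e (+ suc k) ys
  e-∷ k y ys = trans (∑-map-++ ∏ (map (y ∷_) (subsets k ys)) _)
    (+-congʳ (trans (reflexive (≡.cong ∑ (≡.sym (map-∘ (subsets k ys)))))
                    (∑-*ˡ y ∏ (subsets k ys))))

  -- The generating function of the h_k gains a factor 1 / (1 - y t) with each variable y; on
  -- coefficients this is the recursion `h-∷`.
  convolution-h : ∀ y ys k → convolution (y ^_) (λ i → h (+ i) ys) k ≈ h (+ k) (y ∷ ys)
  convolution-h y ys zero    = *-identityˡ _
  convolution-h y ys (suc k) = begin
    1# * h (+ suc k) ys + convolution (λ i → y * y ^ i) (λ i → h (+ i) ys) k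
      ≈⟨ +-cong (*-identityˡ _) (convolution-scale y (y ^_) _ k) ⟩
    h (+ suc k) ys + y * convolution (y ^_) (λ i → h (+ i) ys) k
      ≈⟨ +-comm _ _ ⟩
    y * convolution (y ^_) (λ i → h (+ i) ys) k + h (+ suc k) ys
      ≈⟨ +-congʳ (*-congˡ (convolution-h y ys k)) ⟩
    y * h (+ k) (y ∷ ys) + h (+ suc k) ys
      ≈⟨ h-∷ k y ys ⟨
    h (+ suc k) (y ∷ ys) ∎

  -- The coefficients of the product of the factors 1 - y t over the entries y of `ys`.
  signedE : List Carrier → ℕ → Carrier
  signedE ys k = (- 1#) ^ k * e (+ k) ys

  linear : Carrier → ℕ → Carrier
  linear y 0             = 1#
  linear y 1             = - y
  linear y (suc (suc _)) = 0#

  convolution-signedE : ∀ y ys k → convolution (linear y) (signedE ys) k ≈ signedE (y ∷ ys) k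
  convolution-signedE y ys zero    = *-identityˡ _
  convolution-signedE y ys (suc k) = begin
    1# * signedE ys (suc k) + convolution (linear y ∘ suc) (signedE ys) k
      ≈⟨ +-cong (*-identityˡ _) (convolution-point (signedE ys) (λ _ → refl) k) ⟩
    s * e (+ suc k) ys + - y * ((- 1#) ^ k * e (+ k) ys)
      ≈⟨ +-comm _ _ ⟩
    - y * ((- 1#) ^ k * e (+ k) ys) + s * e (+ suc k) ys
      ≈⟨ +-congʳ (*-congʳ (-1*x≈-x y)) ⟨
    (- 1# * y) * ((- 1#) ^ k * e (+ k) ys) + s * e (+ suc k) ys
      ≈⟨ +-congʳ (*.interchange _ _ _ _) ⟩
    s * (y * e (+ k) ys) + s * e (+ suc k) ys
      ≈⟨ *-distribˡ-+ _ _ _ ⟨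
    s * (y * e (+ k) ys + e (+ suc k) ys)
      ≈⟨ *-congˡ (e-∷ k y ys) ⟨
    s * e (+ suc k) (y ∷ ys) ∎
    where s = (- 1#) ^ suc k

  module _ {N : ℕ} where
    open PowerSeries rawRing N using (Series)
    private module N = PowerSeries rawRing N
    private module S = RawRing N.rawRing

    *ₛ-cong : ∀ {f f′ g g′ : Series} → f S.≈ f′ → g S.≈ g′ → (f S.* g) S.≈ (f′ S.* g′)
    *ₛ-cong f≈ g≈ α = ∑-cong (λ (β , γ) → *-cong (f≈ β) (g≈ γ)) (splittings α)

    sumₛ-cong : ∀ {n} {f g : Fin n → Series} → (∀ j → f j S.≈ g j) → N.sum f S.≈ N.sum g
    sumₛ-cong {zero}  f≈g α = refl
    sumₛ-cong {suc n} f≈g α = +-cong (f≈g zero α) (sumₛ-cong (f≈g ∘ suc) α)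

    sumₛ-coefficient : ∀ {n} (f : Fin n → Series) α → N.sum f α ≈ sum (λ j → f j α)
    sumₛ-coefficient {zero}  f α = refl
    sumₛ-coefficient {suc n} f α = +-congˡ (sumₛ-coefficient (f ∘ suc) α)

    laplaceTerm : ∀ {n} → (Fin (suc n) → Fin (suc n) → Series) → Fin (suc n) → Series
    laplaceTerm A j =
      ((S.- S.1#) N.^ toℕ j S.* A zero j) S.* N.det λ r s → A (suc r) (punchIn j s)

    detₛ-cong : ∀ {n} {A B : Fin n → Fin n → Series} → (∀ i j → A i j S.≈ B i j) →
      N.det A S.≈ N.det B
    detₛ-cong {zero}          A≈B = λ _ → refl
    detₛ-cong {suc n} {A} {B} A≈B = sumₛ-cong {f = laplaceTerm A} {laplaceTerm B} (λ j →
      *ₛ-cong (*ₛ-cong {(S.- S.1#) N.^ toℕ j} (λ _ → refl) (A≈B zero j))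
              (detₛ-cong (λ r s → A≈B (suc r) (punchIn j s))))

  -- The exponent of the first variable is split off; for each way of dividing it, what remains is a
  -- product in the other variables.
  *ₛ-∷ : ∀ {N} (f g : PS.Series (suc N)) k α → RawRing._*_ (PS.rawRing (suc N)) f g (k ∷ α) ≈
    ∑ (applyUpTo (λ i → ∑ (map (λ (β , γ) → f (i ∷ β) * g (k ∸ i ∷ γ)) (splittings α))) (suc k))
  *ₛ-∷ f g k α = trans (∑-cartesianProductWith _ _ (upTo (suc k)) (splittings α))
    (reflexive (∑-upTo _ (suc k)))

  constant-* : ∀ {N} c (g : PS.Series N) α →
    RawRing._*_ (PS.rawRing N) (PS.constant N c) g α ≈ c * g α
  constant-* c g []      = +-identityʳ _
  constant-* {suc N} c g (k ∷ α) = begin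
    RawRing._*_ (PS.rawRing (suc N)) (PS.constant (suc N) c) g (k ∷ α)
      ≈⟨ *ₛ-∷ (PS.constant (suc N) c) g k α ⟩
    ∑ (map (λ (β , γ) → PS.constant N c β * g (k ∷ γ)) (splittings α)) + _
      ≈⟨ +-cong (constant-* c (λ γ → g (k ∷ γ)) α)
           (∑-applyUpTo-0 (λ i → ∑-0 (λ (β , γ) → zeroˡ _) (splittings α)) k) ⟩
    c * g (k ∷ α) + 0#
      ≈⟨ +-identityʳ _ ⟩
    c * g (k ∷ α) ∎

  -- The embedding of series that do not involve the first variable. The minors along the first row
  -- lie in its image.
  lift : ∀ {N} → PS.Series N → PS.Series (suc N)
  lift f (zero  ∷ α) = f α
  lift f (suc _ ∷ α) = 0#

  module _ {N : ℕ} where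
    private
      module N   = PowerSeries rawRing N
      module S   = RawRing N.rawRing
      module N⁺  = PowerSeries rawRing (suc N)
      module S⁺  = RawRing N⁺.rawRing

    lift-cong : ∀ {f g : N.Series} → f S.≈ g → lift f S⁺.≈ lift g
    lift-cong f≈g (zero  ∷ α) = f≈g α
    lift-cong f≈g (suc _ ∷ α) = refl

    lift-* : ∀ (f g : N.Series) → lift f S⁺.* lift g S⁺.≈ lift (f S.* g)
    lift-* f g (zero ∷ α) = trans (*ₛ-∷ (lift f) (lift g) 0 α) (+-identityʳ _)
    lift-* f g (suc k ∷ α) = trans (*ₛ-∷ (lift f) (lift g) (suc k) α)
      (trans (+-cong (∑-0 (λ (β , γ) → zeroʳ _) (splittings α))
                     (∑-applyUpTo-0 (λ i → ∑-0 (λ (β , γ) → zeroˡ (lift g (k ∸ i ∷ γ))) (splittings α)) (suc k)))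
             (+-identityˡ 0#))

    lift-1 : S⁺.1# S⁺.≈ lift S.1#
    lift-1 (zero  ∷ α) = refl
    lift-1 (suc _ ∷ α) = refl

    lift-neg : ∀ (f : N.Series) → (S⁺.- lift f) S⁺.≈ lift (S.- f)
    lift-neg f (zero  ∷ α) = refl
    lift-neg f (suc _ ∷ α) = -0#≈0#

    lift-sum : ∀ {n} {f : Fin n → N⁺.Series} {g : Fin n → N.Series} →
      (∀ j → f j S⁺.≈ lift (g j)) → N⁺.sum f S⁺.≈ lift (N.sum g)
    lift-sum {zero}  f≈ (zero  ∷ α) = refl
    lift-sum {zero}  f≈ (suc _ ∷ α) = refl
    lift-sum {suc n} f≈ (zero  ∷ α) = +-cong (f≈ zero (0 ∷ α)) (lift-sum (f≈ ∘ suc) (0 ∷ α))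
    lift-sum {suc n} f≈ (suc k ∷ α) =
      trans (+-cong (f≈ zero (suc k ∷ α)) (lift-sum (f≈ ∘ suc) (suc k ∷ α))) (+-identityˡ 0#)

    lift-sign : ∀ j → ((S⁺.- S⁺.1#) N⁺.^ j) S⁺.≈ lift ((S.- S.1#) N.^ j)
    lift-sign zero      = lift-1
    lift-sign (suc j) α = trans
      (*ₛ-cong {f = S⁺.- S⁺.1#} {lift (S.- S.1#)}
        (λ β → trans (-‿cong (lift-1 β)) (lift-neg S.1# β)) (lift-sign j) α)
      (lift-* (S.- S.1#) ((S.- S.1#) N.^ j) α)

    lift-det : ∀ {n} {A : Fin n → Fin n → N⁺.Series} {B : Fin n → Fin n → N.Series} →
      (∀ i j → A i j S⁺.≈ lift (B i j)) → N⁺.det A S⁺.≈ lift (N.det B)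
    lift-det {zero} A≈ = lift-1
    lift-det {suc n} {A} {B} A≈ = lift-sum {suc n} (λ j α → trans
      (*ₛ-cong
        (λ β → trans (*ₛ-cong (lift-sign (toℕ j)) (A≈ zero j) β) (lift-* ((S.- S.1#) N.^ toℕ j) (B zero j) β))
        (lift-det (λ r s → A≈ (suc r) (punchIn j s))) α)
      (lift-* _ _ α))

    inVariable-suc : ∀ (i : Fin N) u → N⁺.inVariable (suc i) u S⁺.≈ lift (N.inVariable i u)
    inVariable-suc i u (zero  ∷ α) = refl
    inVariable-suc i u (suc _ ∷ α) = refl

    -- The factors share no variable, so only the splitting that gives all of k to the first factor
    -- survives; it is the last summand.
    inVariable-zero-*-lift : ∀ u (f : N.Series) k α →
      (N⁺.inVariable zero u S⁺.* lift f) (k ∷ α) ≈ u k * f α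
    inVariable-zero-*-lift u f k α = begin
      (N⁺.inVariable zero u S⁺.* lift f) (k ∷ α)
        ≈⟨ *ₛ-∷ (N⁺.inVariable zero u) (lift f) k α ⟩
      ∑ (applyUpTo (λ i → (N.constant (u i) S.* λ γ → lift f (k ∸ i ∷ γ)) α) (suc k))
        ≈⟨ ∑-applyUpTo-cong (λ i → constant-* (u i) (λ γ → lift f (k ∸ i ∷ γ)) α) (suc k) ⟩
      ∑ (applyUpTo (λ i → u i * lift f (k ∸ i ∷ α)) (suc k))
        ≈⟨ top u k ⟩
      u k * f α ∎
      where
      top : ∀ u k → ∑ (applyUpTo (λ i → u i * lift f (k ∸ i ∷ α)) (suc k)) ≈ u k * f α
      top u zero    = +-identityʳ _
      top u (suc k) = trans (+-cong (zeroʳ _) (top (u ∘ suc) k)) (+-identityˡ _)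

  module _ {N : ℕ} where
    private
      module N = PowerSeries rawRing N
      module S = RawRing N.rawRing

    inVariable-cong : ∀ (i : Fin N) {u v} → (∀ k → u k ≈ v k) → N.inVariable i u S.≈ N.inVariable i v
    inVariable-cong i u≈v α = if-cong (does (Vec.≡-dec _≟_ (updateAt α i (λ _ → 0)) (replicate N 0))) (u≈v (lookup α i)) refl

  inVariable-* : ∀ {N} (i : Fin N) u v α →
    RawRing._*_ (PS.rawRing N) (PS.inVariable N i u) (PS.inVariable N i v) α ≈
    PS.inVariable N i (convolution u v) α
  inVariable-* {suc N} zero u v (k ∷ α) = begin
    RawRing._*_ (PS.rawRing (suc N)) (PS.inVariable (suc N) zero u) (PS.inVariable (suc N) zero v) (k ∷ α)
      ≈⟨ *ₛ-∷ (PS.inVariable (suc N) zero u) (PS.inVariable (suc N) zero v) k α ⟩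
    -- With the exponent of the first variable fixed at i, `inVariable zero u` is the constant
    -- series `u i` in the others.
    _ ≈⟨ ∑-applyUpTo-cong (λ i → constant-* (u i) (λ γ → PS.constant N (v (k ∸ i)) γ) α) (suc k) ⟩
    ∑ (applyUpTo (λ i → u i * (if α≟0 then v (k ∸ i) else 0#)) (suc k))
      ≈⟨ select α≟0 ⟩
    (if α≟0 then convolution u v k else 0#) ∎
    where
    α≟0 = does (Vec.≡-dec _≟_ α (replicate N 0))
    select : ∀ b → ∑ (applyUpTo (λ i → u i * (if b then v (k ∸ i) else 0#)) (suc k)) ≈
      (if b then convolution u v k else 0#)
    select true  = ∑≈convolution u v k
    select false = ∑-applyUpTo-0 (λ i → zeroʳ (u i)) (suc k)
  inVariable-* {suc N} (suc i) u v α = begin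
    RawRing._*_ (PS.rawRing (suc N)) (PS.inVariable (suc N) (suc i) u) (PS.inVariable (suc N) (suc i) v) α
      ≈⟨ *ₛ-cong (inVariable-suc i u) (inVariable-suc i v) α ⟩
    RawRing._*_ (PS.rawRing (suc N)) (lift (PS.inVariable N i u)) (lift (PS.inVariable N i v)) α
      ≈⟨ lift-* _ _ α ⟩
    lift (RawRing._*_ (PS.rawRing N) (PS.inVariable N i u) (PS.inVariable N i v)) α
      ≈⟨ lift-cong (inVariable-* i u v) α ⟩
    lift (PS.inVariable N i (convolution u v)) α
      ≈⟨ inVariable-suc i (convolution u v) α ⟨
    PS.inVariable (suc N) (suc i) (convolution u v) α ∎

  constant≈inVariable : ∀ {N} (i : Fin N) u → (∀ k → u (suc k) ≈ 0#) → ∀ α →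
    PS.constant N (u 0) α ≈ PS.inVariable N i u α
  constant≈inVariable zero    u u≈0 (zero  ∷ α) = refl
  constant≈inVariable zero    u u≈0 (suc k ∷ α) = sym (if-zero _ (u≈0 k))
  constant≈inVariable (suc i) u u≈0 (zero  ∷ α) = constant≈inVariable i u u≈0 α
  constant≈inVariable (suc i) u u≈0 (suc k ∷ α) = refl

  module _ {N : ℕ} where
    private
      module N = PowerSeries rawRing N
      module S = RawRing N.rawRing

    x≈inVariable : ∀ (i : Fin N) → N.x i S.≈ N.inVariable i (δ 1)
    x≈inVariable i α with does (Vec.≡-dec _≟_ (updateAt α i (λ _ → 0)) (replicate N 0)) | lookup α i
    ... | false | _           = refl
    ... | true  | 0           = refl
    ... | true  | 1           = refl
    ... | true  | suc (suc k) = refl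

    x-^ : ∀ (i : Fin N) m → (N.x i N.^ m) S.≈ N.inVariable i (δ m)
    x-^ i zero    α = constant≈inVariable i (δ 0) (λ _ → refl) α
    x-^ i (suc m) α = begin
      (N.x i S.* N.x i N.^ m) α
        ≈⟨ *ₛ-cong {f = N.x i} (x≈inVariable i) (x-^ i m) α ⟩
      (N.inVariable i (δ 1) S.* N.inVariable i (δ m)) α
        ≈⟨ inVariable-* i (δ 1) (δ m) α ⟩
      N.inVariable i (convolution (δ 1) (δ m)) α
        ≈⟨ inVariable-cong i (λ k → trans (convolution-δ 1 (δ m) k) (shift-1 k)) α ⟩
      N.inVariable i (δ (suc m)) α ∎
      where
      shift-1 : ∀ k → shift 1 (δ m) k ≈ δ (suc m) k
      shift-1 zero    = refl
      shift-1 (suc k) = refl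

    ∏-geometric : ∀ (i : Fin N) cs →
      N.∏ (map (λ c → N.geometric c i) cs) S.≈ N.inVariable i (λ k → h (+ k) cs)
    ∏-geometric i []       α = trans (constant≈inVariable i (δ 0) (λ _ → refl) α)
      (inVariable-cong i {δ 0} {λ k → h (+ k) []} (λ { zero → sym (+-identityʳ 1#) ; (suc k) → refl }) α)
    ∏-geometric i (c ∷ cs) α = begin
      (N.geometric c i S.* N.∏ (map (λ c → N.geometric c i) cs)) α
        ≈⟨ *ₛ-cong {f = N.geometric c i} (λ _ → refl) (∏-geometric i cs) α ⟩
      (N.geometric c i S.* N.inVariable i (λ k → h (+ k) cs)) α
        ≈⟨ inVariable-* i (c ^_) (λ k → h (+ k) cs) α ⟩
      N.inVariable i (convolution (c ^_) (λ k → h (+ k) cs)) α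
        ≈⟨ inVariable-cong i (convolution-h c cs) α ⟩
      N.inVariable i (λ k → h (+ k) (c ∷ cs)) α ∎

    1-cx : ∀ (i : Fin N) c → (S.1# S.+ S.- (N.constant c S.* N.x i)) S.≈ N.inVariable i (linear c)
    1-cx i c α = trans
      (+-cong (constant≈inVariable i (δ 0) (λ _ → refl) α) (-‿cong (trans (constant-* c (N.x i) α) (*-congˡ (x≈inVariable i α)))))
      (coefficient (does (Vec.≡-dec _≟_ (updateAt α i (λ _ → 0)) (replicate N 0))) (lookup α i))
      where
      coefficient : ∀ b k → (if b then δ 0 k else 0#) + - (c * (if b then δ 1 k else 0#)) ≈
        (if b then linear c k else 0#)
      coefficient false k             = trans (x-0≈x (zeroʳ c)) refl
      coefficient true  0             = x-0≈x (zeroʳ c)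
      coefficient true  1             = trans (+-identityˡ _) (-‿cong (*-identityʳ c))
      coefficient true  (suc (suc k)) = x-0≈x (zeroʳ c)

    ∏-linear : ∀ (i : Fin N) cs →
      N.∏ (map (λ c → S.1# S.+ S.- (N.constant c S.* N.x i)) cs) S.≈ N.inVariable i (signedE cs)
    ∏-linear i []       α = trans (constant≈inVariable i (δ 0) (λ _ → refl) α)
      (inVariable-cong i {δ 0} {signedE []} (λ { zero → sym (trans (*-identityˡ _) (+-identityʳ 1#)) ; (suc k) → sym (zeroʳ _) }) α)
    ∏-linear i (c ∷ cs) α = begin
      ((S.1# S.+ S.- (N.constant c S.* N.x i)) S.* N.∏ (map (λ c → S.1# S.+ S.- (N.constant c S.* N.x i)) cs)) α
        ≈⟨ *ₛ-cong (1-cx i c) (∏-linear i cs) α ⟩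
      (N.inVariable i (linear c) S.* N.inVariable i (signedE cs)) α
        ≈⟨ inVariable-* i (linear c) (signedE cs) α ⟩
      N.inVariable i (convolution (linear c) (signedE cs)) α
        ≈⟨ inVariable-cong i (convolution-signedE c cs) α ⟩
      N.inVariable i (signedE (c ∷ cs)) α ∎

    sign≈constant : ∀ j → ((S.- S.1#) N.^ j) S.≈ N.constant ((- 1#) ^ j)
    sign≈constant zero    α = refl
    sign≈constant (suc j) α = begin
      ((S.- S.1#) S.* (S.- S.1#) N.^ j) α
        ≈⟨ *ₛ-cong {f = S.- S.1#} {N.constant (- 1#)} (λ β → neg-if _) (sign≈constant j) α ⟩
      (N.constant (- 1#) S.* N.constant ((- 1#) ^ j)) α
        ≈⟨ constant-* (- 1#) (N.constant ((- 1#) ^ j)) α ⟩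
      - 1# * N.constant ((- 1#) ^ j) α
        ≈⟨ *-if (- 1#) _ ⟩
      N.constant ((- 1#) ^ suc j) α ∎
      where
      neg-if : ∀ b → - (if b then 1# else 0#) ≈ (if b then - 1# else 0#)
      neg-if true  = refl
      neg-if false = -0#≈0#
      *-if : ∀ c b {x} → c * (if b then x else 0#) ≈ (if b then c * x else 0#)
      *-if c true  = refl
      *-if c false = zeroʳ c

    sign-*-inVariable : ∀ j (i : Fin N) u →
      ((S.- S.1#) N.^ j S.* N.inVariable i u) S.≈ N.inVariable i (λ k → (- 1#) ^ j * u k)
    sign-*-inVariable j i u α = begin
      ((S.- S.1#) N.^ j S.* N.inVariable i u) α
        ≈⟨ *ₛ-cong {g = N.inVariable i u} (sign≈constant j) (λ _ → refl) α ⟩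
      (N.constant ((- 1#) ^ j) S.* N.inVariable i u) α
        ≈⟨ constant-* ((- 1#) ^ j) (N.inVariable i u) α ⟩
      (- 1#) ^ j * N.inVariable i u α
        ≈⟨ *-if _ ⟩
      N.inVariable i (λ k → (- 1#) ^ j * u k) α ∎
      where
      *-if : ∀ b {c x} → c * (if b then x else 0#) ≈ (if b then c * x else 0#)
      *-if true  = refl
      *-if false = zeroʳ _

  -- In the Laplace expansion the first row involves only the first variable and the minors are
  -- lifts, so k goes to the row and α to the minor, which is handled by induction.
  det-inVariable : ∀ {N} (u : Fin N → ℕ → Carrier) α →
    PS.det N (λ i j → PS.inVariable N i (u j)) α ≈ det (λ i j → u j (lookup α i))
  det-inVariable {zero}  u []      = refl
  det-inVariable {suc N} u (k ∷ α) = begin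
    N⁺.det (λ i j → N⁺.inVariable i (u j)) (k ∷ α)
      ≈⟨ sumₛ-coefficient (laplaceTerm (λ i j → N⁺.inVariable i (u j))) (k ∷ α) ⟩
    sum (λ j → laplaceTerm (λ i j → N⁺.inVariable i (u j)) j (k ∷ α))
      ≈⟨ sum-cong {suc N} term ⟩
    sum (λ j → (- 1#) ^ toℕ j * u j k * det (λ r s → u (punchIn j s) (lookup α r))) ∎
    where
    module N⁺ = PowerSeries rawRing (suc N)
    module S⁺ = RawRing N⁺.rawRing
    minor : Fin (suc N) → N⁺.Series
    minor j = N⁺.det (λ r s → N⁺.inVariable (suc r) (u (punchIn j s)))
    term : ∀ j → ((((S⁺.- S⁺.1#) N⁺.^ toℕ j) S⁺.* N⁺.inVariable zero (u j)) S⁺.* minor j) (k ∷ α) ≈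
      (- 1#) ^ toℕ j * u j k * det (λ r s → u (punchIn j s) (lookup α r))
    term j = begin
      ((((S⁺.- S⁺.1#) N⁺.^ toℕ j) S⁺.* N⁺.inVariable zero (u j)) S⁺.* minor j) (k ∷ α)
        ≈⟨ *ₛ-cong {f = (S⁺.- S⁺.1#) N⁺.^ toℕ j S⁺.* N⁺.inVariable zero (u j)} (sign-*-inVariable (toℕ j) zero (u j))
             (lift-det (λ r s → inVariable-suc r (u (punchIn j s)))) (k ∷ α) ⟩
      (N⁺.inVariable zero (λ k → (- 1#) ^ toℕ j * u j k) S⁺.*
        lift (PS.det N (λ r s → PS.inVariable N r (u (punchIn j s))))) (k ∷ α)
        ≈⟨ inVariable-zero-*-lift _ _ k α ⟩
      (- 1#) ^ toℕ j * u j k * PS.det N (λ r s → PS.inVariable N r (u (punchIn j s))) α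
        ≈⟨ *-congˡ (det-inVariable (λ s → u (punchIn j s)) α) ⟩
      (- 1#) ^ toℕ j * u j k * det (λ r s → u (punchIn j s) (lookup α r)) ∎

  -- Row i depends on i only through the exponent at position i. Indexing rows by exponents makes
  -- the coefficient a function of the list of exponents, to which `Det-alternating` applies.
  detₛ≈Det : ∀ {N} {C : Set} (row : ℕ → C → Carrier) (col : Fin N → C) {A : Fin N → Fin N → PS.Series N} →
    (∀ i j α → A i j α ≈ PS.inVariable N i (λ k → row k (col j)) α) →
    ∀ α → PS.det N A α ≈ Det (map row (toList α)) (tabulate col)
  detₛ≈Det {N} row col {A} A≈ α = begin
    PS.det N A α
      ≈⟨ detₛ-cong A≈ α ⟩
    PS.det N (λ i j → PS.inVariable N i (λ k → row k (col j))) α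
      ≈⟨ det-inVariable (λ j k → row k (col j)) α ⟩
    det (λ i j → row (lookup α i) (col j))
      ≈⟨ det≈Det (λ i → row (lookup α i)) col ⟩
    Det (tabulate (λ i → row (lookup α i))) (tabulate col)
      ≡⟨ ≡.cong (λ rs → Det rs (tabulate col)) (tabulate-lookup row α) ⟩
    Det (map row (toList α)) (tabulate col) ∎

-- Degrees and the number of Vandermonde factors

sum-updateAt : ∀ {N} (α : Vec ℕ N) i f →
  Vec.sum (updateAt α i f) ℕ.+ lookup α i ≡ Vec.sum α ℕ.+ f (lookup α i)
sum-updateAt (k ∷ α) zero    f = begin
  (f k ℕ.+ Vec.sum α) ℕ.+ k ≡⟨ solve 3 (λ k s l → (k :+ s) :+ l := (l :+ s) :+ k) ≡.refl (f k) (Vec.sum α) k ⟩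
  (k ℕ.+ Vec.sum α) ℕ.+ f k ∎
  where open ≡-Reasoning; open +-*-Solver
sum-updateAt (k ∷ α) (suc i) f = begin
  (k ℕ.+ Vec.sum (updateAt α i f)) ℕ.+ lookup α i ≡⟨ ℕ.+-assoc k _ _ ⟩
  k ℕ.+ (Vec.sum (updateAt α i f) ℕ.+ lookup α i) ≡⟨ ≡.cong (k ℕ.+_) (sum-updateAt α i f) ⟩
  k ℕ.+ (Vec.sum α ℕ.+ f (lookup α i))            ≡⟨ ℕ.+-assoc k _ _ ⟨
  (k ℕ.+ Vec.sum α) ℕ.+ f (lookup α i) ∎
  where open ≡-Reasoning

-- One exponent rises by k + 1 and another falls by k, hence a net gain of one degree. The bound on
-- k makes the truncated subtraction exact, and i ≢ j keeps the two updates independent.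
sum-raise-lower : ∀ {N} (α : Vec ℕ N) {i j} k → i ≢ j → k ℕ.≤ lookup α j →
  Vec.sum (updateAt (updateAt α i (λ m → m ℕ.+ suc k)) j (_∸ k)) ≡ suc (Vec.sum α)
sum-raise-lower α {i} {j} k i≢j k≤αⱼ = ℕ.+-cancelʳ-≡ (k ℕ.+ lookup α i ℕ.+ lookup α j) _ _ (begin
  t ℕ.+ (k ℕ.+ aᵢ ℕ.+ aⱼ)             ≡⟨ solve 4 (λ t k x y → t :+ (k :+ x :+ y) := t :+ y :+ (k :+ x)) ≡.refl t k aᵢ aⱼ ⟩
  t ℕ.+ aⱼ ℕ.+ (k ℕ.+ aᵢ)             ≡⟨ ≡.cong (λ x → t ℕ.+ x ℕ.+ (k ℕ.+ aᵢ)) (Vec.lookup∘updateAt′ j i (i≢j ∘ ≡.sym) α) ⟨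
  t ℕ.+ lookup β j ℕ.+ (k ℕ.+ aᵢ)     ≡⟨ ≡.cong (ℕ._+ (k ℕ.+ aᵢ)) (sum-updateAt β j (_∸ k)) ⟩
  s ℕ.+ (lookup β j ∸ k) ℕ.+ (k ℕ.+ aᵢ) ≡⟨ ≡.cong (λ x → s ℕ.+ (x ∸ k) ℕ.+ (k ℕ.+ aᵢ)) (Vec.lookup∘updateAt′ j i (i≢j ∘ ≡.sym) α) ⟩
  s ℕ.+ (aⱼ ∸ k) ℕ.+ (k ℕ.+ aᵢ)       ≡⟨ solve 4 (λ s d k x → s :+ d :+ (k :+ x) := s :+ x :+ (d :+ k)) ≡.refl s (aⱼ ∸ k) k aᵢ ⟩
  s ℕ.+ aᵢ ℕ.+ (aⱼ ∸ k ℕ.+ k)         ≡⟨ ≡.cong₂ ℕ._+_ (sum-updateAt α i (λ m → m ℕ.+ suc k)) (ℕ.m∸n+n≡m k≤αⱼ) ⟩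
  Vec.sum α ℕ.+ (aᵢ ℕ.+ suc k) ℕ.+ aⱼ ≡⟨ solve 4 (λ s x k y → s :+ (x :+ (con 1 :+ k)) :+ y := con 1 :+ s :+ (k :+ x :+ y)) ≡.refl (Vec.sum α) aᵢ k aⱼ ⟩
  suc (Vec.sum α) ℕ.+ (k ℕ.+ aᵢ ℕ.+ aⱼ) ∎)
  where
  open ≡-Reasoning
  open +-*-Solver
  β  = updateAt α i (λ m → m ℕ.+ suc k)
  s  = Vec.sum β
  t  = Vec.sum (updateAt β j (_∸ k))
  aᵢ = lookup α i
  aⱼ = lookup α j

-- N(N-1)/2, which is both the number of factors of the Vandermonde product and the sum of the
-- exponents N-1, ..., 1, 0.
staircase : ℕ → ℕ
staircase zero    = 0
staircase (suc N) = N ℕ.+ staircase N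

length-filter-map : ∀ {A B : Set} {P : B → Set} {Q : A → Set} (P? : Decidable P) (Q? : Decidable Q) (f : A → B) →
  (∀ x → does (P? (f x)) ≡ does (Q? x)) → ∀ xs → length (filter P? (map f xs)) ≡ length (filter Q? xs)
length-filter-map P? Q? f eq []       = ≡.refl
length-filter-map P? Q? f eq (x ∷ xs) with does (P? (f x)) | does (Q? x) | eq x
... | true  | true  | _ = ≡.cong suc (length-filter-map P? Q? f eq xs)
... | false | false | _ = length-filter-map P? Q? f eq xs

count> : ∀ {N} → Fin N → ℕ
count> {N} i = length (filter (i Fin.<?_) (allFin N))

count>-zero : ∀ N → count> {suc N} zero ≡ N
count>-zero N = ≡.trans
  (≡.cong length (filter-all {P = Fin.zero {N} Fin.<_} (Fin.zero {N} Fin.<?_) (All.tabulate⁺ {f = Fin.suc {N}} (λ j → ℕ.z<s {toℕ j}))))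
  (length-tabulate (Fin.suc {N}))

count>-suc : ∀ {N} (i : Fin N) → count> (suc i) ≡ count> i
count>-suc {N} i = ≡.trans
  (≡.cong (λ js → length (filter (suc i Fin.<?_) js)) (≡.sym (map-tabulate {n = N} id Fin.suc)))
  (length-filter-map {P = suc i Fin.<_} {i Fin.<_} (suc i Fin.<?_) (i Fin.<?_) suc (λ _ → ≡.refl) (allFin N))

sum-count> : ∀ N → ℕ.sum (map count> (allFin N)) ≡ staircase N
sum-count> zero    = ≡.refl
sum-count> (suc N) = ≡.cong₂ ℕ._+_ (count>-zero N) (begin
  ℕ.sum (map count> (tabulate (Fin.suc {N})))          ≡⟨ ≡.cong (ℕ.sum ∘ map count>) (map-tabulate {n = N} id Fin.suc) ⟨
  ℕ.sum (map count> (map Fin.suc (allFin N)))    ≡⟨ ≡.cong ℕ.sum (map-∘ (allFin N)) ⟨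
  ℕ.sum (map (count> ∘ Fin.suc) (allFin N))      ≡⟨ ≡.cong ℕ.sum (map-cong count>-suc (allFin N)) ⟩
  ℕ.sum (map count> (allFin N))              ≡⟨ sum-count> N ⟩
  staircase N                                ∎)
  where open ≡-Reasoning

length-filter-cartesianProduct : ∀ {N} {P : Fin N × Fin N → Set} (P? : Decidable P) →
  (∀ i j → does (P? (i , j)) ≡ does (i Fin.<? j)) → ∀ is →
  length (filter P? (cartesianProduct is (allFin N))) ≡ ℕ.sum (map count> is)
length-filter-cartesianProduct P? eq []       = ≡.refl
length-filter-cartesianProduct {N} P? eq (i ∷ is) = begin
  length (filter P? (map (i ,_) (allFin N) ++ cartesianProduct is (allFin N)))
    ≡⟨ ≡.cong length (filter-++ P? (map (i ,_) (allFin N)) _) ⟩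
  length (filter P? (map (i ,_) (allFin N)) ++ filter P? (cartesianProduct is (allFin N)))
    ≡⟨ length-++ (filter P? (map (i ,_) (allFin N))) ⟩
  length (filter P? (map (i ,_) (allFin N))) ℕ.+ length (filter P? (cartesianProduct is (allFin N)))
    ≡⟨ ≡.cong₂ ℕ._+_ (length-filter-map P? (i Fin.<?_) (i ,_) (eq i) (allFin N))
         (length-filter-cartesianProduct P? eq is) ⟩
  count> i ℕ.+ ℕ.sum (map count> is) ∎
  where open ≡-Reasoning

-- Division by the Vandermonde product as a linear operator

module Division (K : CommutativeRing 0ℓ 0ℓ) where

  open CommutativeRing K hiding (zero)
  open RingOperations rawRing using (∑)
  open Sums K

  ∑-upTo-cong : ∀ {f g : ℕ → Carrier} n → (∀ k → k < n → f k ≈ g k) →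
    ∑ (map f (upTo n)) ≈ ∑ (map g (upTo n))
  ∑-upTo-cong {f} {g} n f≈g =
    trans (reflexive (∑-upTo f n)) (trans (cong< n f≈g) (reflexive (≡.sym (∑-upTo g n))))
    where
    cong< : ∀ {f g : ℕ → Carrier} n → (∀ k → k < n → f k ≈ g k) → ∑ (applyUpTo f n) ≈ ∑ (applyUpTo g n)
    cong< zero    f≈g = refl
    cong< (suc n) f≈g = +-cong (f≈g 0 ℕ.z<s) (cong< n (λ k k<n → f≈g (suc k) (ℕ.s<s k<n)))

  ∑-swap : ∀ {I J : Set} (f : I → J → Carrier) is js →
    ∑ (map (λ i → ∑ (map (f i) js)) is) ≈ ∑ (map (λ j → ∑ (map (λ i → f i j) is)) js)
  ∑-swap f []       js = sym (∑-0 (λ _ → refl) js)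
  ∑-swap f (i ∷ is) js = trans (+-congˡ (∑-swap f is js)) (sym (∑-+ (f i) _ js))

  module _ {N : ℕ} where
    open PowerSeries rawRing N using (Series; divideByDifference; _/Vandermonde)

    divide-cong : ∀ {i j} {f g : Series} α → i ≢ j →
      (∀ β → Vec.sum β ≡ suc (Vec.sum α) → f β ≈ g β) →
      divideByDifference (i , j) f α ≈ divideByDifference (i , j) g α
    divide-cong {j = j} α i≢j f≈g = ∑-upTo-cong (suc (lookup α j))
      (λ k k<n → f≈g _ (sum-raise-lower α k i≢j (s≤s⁻¹ k<n)))

    -- Each division looks exactly one degree higher, so the degree that matters is that of α plus
    -- the number of divisions.
    divisions-cong : ∀ {ps} {f g : Series} α → All (λ (i , j) → i ≢ j) ps →
      (∀ β → Vec.sum β ≡ length ps ℕ.+ Vec.sum α → f β ≈ g β) →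
      foldr divideByDifference f ps α ≈ foldr divideByDifference g ps α
    divisions-cong α []       f≈g = f≈g α ≡.refl
    divisions-cong {p ∷ ps} α (i≢j ∷ ds) f≈g = divide-cong α i≢j (λ β ∣β∣ →
      divisions-cong β ds (λ γ ∣γ∣ → f≈g γ
        (≡.trans ∣γ∣ (≡.trans (≡.cong (length ps ℕ.+_) ∣β∣) (ℕ.+-suc (length ps) _)))))

    divisions-∑ : ∀ {I : Set} ps (c : I → Carrier) (f : I → Series) is α →
      foldr divideByDifference (λ β → ∑ (map (λ i → c i * f i β) is)) ps α ≈
      ∑ (map (λ i → c i * foldr divideByDifference (f i) ps α) is)
    divisions-∑ []             c f is α = refl
    divisions-∑ ((i , j) ∷ ps) c f is α = begin
      ∑ (map (λ k → foldr divideByDifference (λ β → ∑ (map (λ ν → c ν * f ν β) is)) ps (γ k)) (upTo n))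
        ≈⟨ ∑-cong (λ k → divisions-∑ ps c f is (γ k)) (upTo n) ⟩
      ∑ (map (λ k → ∑ (map (λ ν → c ν * foldr divideByDifference (f ν) ps (γ k)) is)) (upTo n))
        ≈⟨ ∑-swap (λ k ν → c ν * foldr divideByDifference (f ν) ps (γ k)) (upTo n) is ⟩
      ∑ (map (λ ν → ∑ (map (λ k → c ν * foldr divideByDifference (f ν) ps (γ k)) (upTo n))) is)
        ≈⟨ ∑-cong (λ ν → ∑-*ˡ (c ν) (λ k → foldr divideByDifference (f ν) ps (γ k)) (upTo n)) is ⟩
      ∑ (map (λ ν → c ν * ∑ (map (λ k → foldr divideByDifference (f ν) ps (γ k)) (upTo n))) is) ∎
      where
      open SetoidReasoning setoid
      n = suc (lookup α j)
      γ : ℕ → Vec ℕ N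
      γ k = updateAt (updateAt α i (λ m → m ℕ.+ suc k)) j (_∸ k)

    -- The hypothesis concerns a single degree, because g is in general not a finite combination of
    -- the `f i` in all degrees at once.
    /Vandermonde-∑ : ∀ {I : Set} (c : I → Carrier) (f : I → Series) is g α →
      (∀ β → Vec.sum β ≡ staircase N ℕ.+ Vec.sum α → g β ≈ ∑ (map (λ i → c i * f i β) is)) →
      (g /Vandermonde) α ≈ ∑ (map (λ i → c i * (f i /Vandermonde) α) is)
    /Vandermonde-∑ c f is g α g≈ = trans
      (divisions-cong {ps = filter _ (cartesianProduct (allFin N) (allFin N))} α
        (All.map Fin.<⇒≢ (All.all-filter _ (cartesianProduct (allFin N) (allFin N))))
        (λ β ∣β∣ → g≈ β (≡.trans ∣β∣ (≡.cong (ℕ._+ Vec.sum α)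
          (≡.trans (length-filter-cartesianProduct _ (λ _ _ → ≡.refl) (allFin N)) (sum-count> N))))))
      (divisions-∑ (filter _ (cartesianProduct (allFin N) (allFin N))) c f is α)

-- Sums over partitions with a single nonzero term

module PartitionSums (K : CommutativeRing 0ℓ 0ℓ) where

  open CommutativeRing K hiding (zero)
  open RingOperations rawRing using (∑)
  open Sums K

  ∑-concatMap : ∀ {I J : Set} (φ : J → Carrier) (φ′ : I → Carrier) (g : I → List J) is →
    (∀ i → ∑ (map φ (g i)) ≈ φ′ i) → ∑ (map φ (concatMap g is)) ≈ ∑ (map φ′ is)
  ∑-concatMap φ φ′ g []       eq = refl
  ∑-concatMap φ φ′ g (i ∷ is) eq = trans
    (∑-map-++ φ (g i) (concatMap g is)) (+-cong (eq i) (∑-concatMap φ φ′ g is eq))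

  ∑-mapMaybe : ∀ {I J : Set} (ψ : J → Carrier) (g : I → Maybe J) is →
    ∑ (map ψ (mapMaybe g is)) ≈ ∑ (map (maybe′ ψ 0# ∘ g) is)
  ∑-mapMaybe ψ g []       = refl
  ∑-mapMaybe ψ g (i ∷ is) with g i
  ... | just j  = +-congˡ (∑-mapMaybe ψ g is)
  ... | nothing = trans (∑-mapMaybe ψ g is) (sym (+-identityˡ _))

  -- The composition from which a given one is grown in `compositions`. The values at the empty list
  -- and at a leading zero are defaults.
  parent : List ℕ → List ℕ
  parent []                 = []
  parent (zero ∷ ks)        = ks
  parent (suc zero ∷ ks)    = ks
  parent (suc (suc k) ∷ ks) = suc k ∷ ks

  overChildren : (List ℕ → Carrier) → List ℕ → Carrier
  overChildren φ []       = φ (1 ∷ []) + 0#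
  overChildren φ (k ∷ ks) = φ (1 ∷ k ∷ ks) + (φ (suc k ∷ ks) + 0#)

  ∑-compositions-suc : ∀ m φ →
    ∑ (map φ (compositions (suc m))) ≈ ∑ (map (overChildren φ) (compositions m))
  ∑-compositions-suc m φ = ∑-concatMap φ (overChildren φ) _ (compositions m)
    λ { [] → refl ; (k ∷ ks) → refl }

  -- This expresses that κ is listed exactly once. If φ is supported at κ, its sum over children is
  -- supported at the parent of κ, so the induction on m follows the growth of compositions
  -- backwards.
  ∑-compositions : ∀ m φ κ → All (0 <_) κ → ℕ.sum κ ≡ m →
    (∀ ks → All (0 <_) ks → ks ≢ κ → φ ks ≈ 0#) → ∑ (map φ (compositions m)) ≈ φ κ
  ∑-compositions zero    φ []           pos eq φ≈0 = +-identityʳ _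
  ∑-compositions zero    φ (zero ∷ ks)  (() ∷ _) eq φ≈0
  ∑-compositions zero    φ (suc k ∷ ks) pos () φ≈0
  ∑-compositions (suc m) φ (suc k ∷ ks) (_ ∷ pos) eq φ≈0 = trans (∑-compositions-suc m φ)
    (trans (∑-compositions m (overChildren φ) (parent (suc k ∷ ks)) (positive′ k) (sum-parent k eq) vanish)
           (at-parent k ks pos φ≈0))
    where
    positive′ : ∀ k → All (0 <_) (parent (suc k ∷ ks))
    positive′ zero    = pos
    positive′ (suc k) = z<s ∷ pos

    sum-parent : ∀ k → ℕ.sum (suc k ∷ ks) ≡ suc m → ℕ.sum (parent (suc k ∷ ks)) ≡ m
    sum-parent zero    eq = ℕ.suc-injective eq
    sum-parent (suc k) eq = ℕ.suc-injective eq

    vanish : ∀ js → All (0 <_) js → js ≢ parent (suc k ∷ ks) → overChildren φ js ≈ 0#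
    vanish []           []         js≢ = trans (+-identityʳ _)
      (φ≈0 _ (z<s ∷ []) (js≢ ∘ ≡.cong parent))
    vanish (suc j ∷ js) (_ ∷ pos′) js≢ = trans
      (+-cong (φ≈0 _ (z<s ∷ z<s ∷ pos′) (js≢ ∘ ≡.cong parent))
              (trans (+-identityʳ _) (φ≈0 _ (z<s ∷ pos′) (js≢ ∘ ≡.cong parent))))
      (+-identityˡ 0#)

    at-parent : ∀ k ks → All (0 <_) ks →
      (∀ js → All (0 <_) js → js ≢ suc k ∷ ks → φ js ≈ 0#) →
      overChildren φ (parent (suc k ∷ ks)) ≈ φ (suc k ∷ ks)
    at-parent zero    []           pos        φ≈0 = +-identityʳ _
    at-parent zero    (suc j ∷ ks) (_ ∷ pos)  φ≈0 = trans
      (+-congˡ (trans (+-identityʳ _) (φ≈0 _ (z<s ∷ pos) (λ ())))) (+-identityʳ _)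
    at-parent (suc k) ks           pos        φ≈0 = trans
      (+-cong (φ≈0 _ (z<s ∷ z<s ∷ pos) (λ ())) (+-identityʳ _)) (+-identityˡ _)

  -- Partitions carry proofs, and those built by `toPartition?` may differ from those in ν. Hence
  -- partitions are compared by their parts only, and ψ is required to respect this.
  ∑-partitionsOf : ∀ m (ψ : Partition → Carrier) ν → ℕ.sum (parts ν) ≡ m →
    (∀ ν′ → parts ν′ ≢ parts ν → ψ ν′ ≈ 0#) → (∀ ν′ → parts ν′ ≡ parts ν → ψ ν′ ≈ ψ ν) →
    ∑ (map ψ (partitionsOf m)) ≈ ψ ν
  ∑-partitionsOf m ψ ν@(partition κ d p) eq ψ≈0 ψ≈ = trans
    (∑-mapMaybe ψ toPartition? (compositions m))
    (trans (∑-compositions m (maybe′ ψ 0# ∘ toPartition?) κ p eq (λ ks _ → off ks)) on)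
    where
    off : ∀ ks → ks ≢ κ → maybe′ ψ 0# (toPartition? ks) ≈ 0#
    off ks ks≢κ with linked? _≥?_ ks ×-dec All.all? (0 <?_) ks
    ... | yes _ = ψ≈0 _ ks≢κ
    ... | no _  = refl
    on : maybe′ ψ 0# (toPartition? κ) ≈ ψ ν
    on with linked? _≥?_ κ ×-dec All.all? (0 <?_) κ
    ... | yes _ = ψ≈ _ ≡.refl
    ... | no ¬p = ⊥-elim (¬p (d , p))

-- Partitions with at most N parts as strictly decreasing exponents

-- Missing parts count as 0 and parts beyond the N-th are discarded, so the list always has N
-- entries.
exponents : ℕ → List ℕ → List ℕ
exponents zero    ks       = []
exponents (suc N) []       = N ∷ exponents N []
exponents (suc N) (k ∷ ks) = k ℕ.+ N ∷ exponents N ks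

exponents-tabulate : ∀ N ks →
  tabulate {n = N} (λ j → nth ks (toℕ j) ℕ.+ (N ∸ suc (toℕ j))) ≡ exponents N ks
exponents-tabulate zero    ks       = ≡.refl
exponents-tabulate (suc N) []       = ≡.cong (N ∷_) (exponents-tabulate N [])
exponents-tabulate (suc N) (k ∷ ks) = ≡.cong (k ℕ.+ N ∷_) (exponents-tabulate N ks)

exponents-below : ∀ N k ks → Linked _≥_ (k ∷ ks) → Descending (k ℕ.+ N) (exponents N ks)
exponents-below zero    k ks        dec         = []
exponents-below (suc N) k []        dec         = ℕ.m≤n+m (suc N) k ∷ exponents-below N 0 [] [-]
exponents-below (suc N) k (k′ ∷ ks) (k≥k′ ∷ dec) =
  ≡.subst (k′ ℕ.+ N <_) (≡.sym (ℕ.+-suc k N)) (s≤s (ℕ.+-monoˡ-≤ N k≥k′)) ∷ exponents-below N k′ ks dec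

exponents-descending : ∀ N ν → Σ ℕ λ m → Descending m (exponents N (parts ν))
exponents-descending N       (partition []       dec _) = _ , exponents-below N 0 [] [-]
exponents-descending zero    (partition (k ∷ ks) dec _) = 0 , []
exponents-descending (suc N) (partition (k ∷ ks) dec _) = _ , ℕ.≤-refl ∷ exponents-below N k ks dec

exponents-injective : ∀ N {ks ls} → All (0 <_) ks → All (0 <_) ls → length ks ≤ N → length ls ≤ N →
  exponents N ks ≡ exponents N ls → ks ≡ ls
exponents-injective N       [] [] _ _ eq = ≡.refl
exponents-injective (suc N) [] (_∷_ {x = suc l} _ _) _ _ eq with () ← ℕ.m≢1+n+m N (proj₁ (∷-injective eq))
exponents-injective (suc N) (_∷_ {x = suc k} _ _) [] _ _ eq with () ← ℕ.m≢1+n+m N (≡.sym (proj₁ (∷-injective eq)))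
exponents-injective (suc N) (_∷_ {x = k} _ ps) (_∷_ {x = l} _ qs) (s≤s len) (s≤s len′) eq =
  let eq₀ , eqs = ∷-injective eq in
  ≡.cong₂ _∷_ (ℕ.+-cancelʳ-≡ N k l eq₀) (exponents-injective N ps qs len len′ eqs)

sum-exponents : ∀ N ks → length ks ≤ N → ℕ.sum (exponents N ks) ≡ staircase N ℕ.+ ℕ.sum ks
sum-exponents zero    []       len = ≡.refl
sum-exponents (suc N) []       len = ≡.trans (≡.cong (N ℕ.+_) (sum-exponents N [] z≤n)) (≡.sym (ℕ.+-assoc N _ 0))
sum-exponents (suc N) (k ∷ ks) len = ≡.trans
  (≡.cong (k ℕ.+ N ℕ.+_) (sum-exponents N ks (s≤s⁻¹ len)))
  (solve 4 (λ k N t s → k :+ N :+ (t :+ s) := N :+ t :+ (k :+ s)) ≡.refl k N (staircase N) (ℕ.sum ks))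
  where open +-*-Solver

descending-length : ∀ {m bs} → Descending m bs → length bs ≤ m
descending-length []        = z≤n
descending-length (b<m ∷ d) = ℕ.≤-trans (s≤s (descending-length d)) b<m

descending-tight : ∀ {bs} → Descending (length bs) bs → exponents (length bs) [] ≡ bs
descending-tight []        = ≡.refl
descending-tight (_∷_ {b = b} {bs} b<m d) with ℕ.≤-antisym (s≤s⁻¹ b<m) (descending-length d)
... | ≡.refl = ≡.cong (b ∷_) (descending-tight d)

-- The part belonging to b is b minus the number of later exponents, which is nonnegative since
-- these are distinct naturals below b.
exponents-surjective : ∀ {m bs} → Descending m bs →
  Σ Partition λ ν → (ℓ ν ≤ length bs) × (exponents (length bs) (parts ν) ≡ bs)
exponents-surjective [] = partition [] [] [] , z≤n , ≡.refl
exponents-surjective (_∷_ {b = b} {bs} b<m d) with b ∸ length bs in b-N | exponents-surjective d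
-- A zero part forces all later parts to be zero: the tail consists of as many distinct naturals as
-- there are below b, so `descending-tight` determines it.
... | zero  | _ = partition [] [] [] , z≤n , ≡.cong₂ _∷_ N≡b
  (descending-tight (≡.subst (λ n → Descending n bs) (≡.sym N≡b) d))
  where N≡b = ℕ.≤-antisym (descending-length d) (ℕ.m∸n≡0⇒m≤n b-N)
... | suc k | partition κ dec pos , len , eq =
  partition (suc k ∷ κ) (dominates κ dec len eq) (z<s ∷ pos) , s≤s len , ≡.cong₂ _∷_ k+N≡b eq
  where
  k+N≡b : suc k ℕ.+ length bs ≡ b
  k+N≡b = ≡.trans (≡.cong (ℕ._+ length bs) (≡.sym b-N)) (ℕ.m∸n+n≡m (descending-length d))
  dominates : ∀ κ → Linked _≥_ κ → length κ ≤ length bs → exponents (length bs) κ ≡ bs → Linked _≥_ (suc k ∷ κ)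
  dominates []      _   _   _  = [-]
  dominates (j ∷ κ) dec len eq = bound bs d k+N≡b len eq ∷ dec
    where
    bound : ∀ bs → Descending b bs → suc k ℕ.+ length bs ≡ b → suc (length κ) ≤ length bs →
      exponents (length bs) (j ∷ κ) ≡ bs → j ≤ suc k
    -- The offsets of consecutive exponents differ by one, so the strict c < b turns into a weak
    -- inequality between the parts.
    bound (c ∷ cs) (c<b ∷ _) eqb len eq = ℕ.+-cancelʳ-≤ (length cs) j (suc k) (s≤s⁻¹ (≡.subst₂ _<_
      (≡.sym (proj₁ (∷-injective eq)))
      (≡.trans (≡.sym eqb) (ℕ.+-suc (suc k) (length cs))) c<b))

-- Index ranges, containment and the diagonal of a partition

if-yes : ∀ {A P : Set} (P? : Dec P) {x y : A} → P → (if does P? then x else y) ≡ x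
if-yes P? {x} {y} p = ≡.cong (λ b → if b then x else y) (dec-true P? p)

if-no : ∀ {A P : Set} (P? : Dec P) {x y : A} → ¬ P → (if does P? then x else y) ≡ y
if-no P? {x} {y} ¬p = ≡.cong (λ b → if b then x else y) (dec-false P? ¬p)

range : ℕ → ℕ → List ℕ
range s zero    = []
range s (suc n) = s ∷ range (suc s) n

length-range : ∀ s n → length (range s n) ≡ n
length-range s zero    = ≡.refl
length-range s (suc n) = ≡.cong suc (length-range (suc s) n)

range-++ : ∀ s m n → range s (m ℕ.+ n) ≡ range s m ++ range (s ℕ.+ m) n
range-++ s zero    n = ≡.cong (λ t → range t n) (≡.sym (ℕ.+-identityʳ s))
range-++ s (suc m) n = ≡.cong (s ∷_)
  (≡.trans (range-++ (suc s) m n) (≡.cong (λ t → range (suc s) m ++ range t n) (≡.sym (ℕ.+-suc s m))))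

range-lower : ∀ s n → All (s ≤_) (range s n)
range-lower s zero    = []
range-lower s (suc n) = ℕ.≤-refl ∷ All.map (ℕ.≤-trans (ℕ.n≤1+n s)) (range-lower (suc s) n)

range-upper : ∀ s n → All (_< s ℕ.+ n) (range s n)
range-upper s zero    = []
range-upper s (suc n) = ≡.subst (λ t → All (_< t) (range s (suc n))) (≡.sym (ℕ.+-suc s n))
  (s≤s (ℕ.m≤m+n s n) ∷ range-upper (suc s) n)

applyUpTo-range : ∀ {C : Set} {f g : ℕ → C} s n → (∀ i → g i ≡ f (s ℕ.+ i)) → applyUpTo g n ≡ map f (range s n)
applyUpTo-range         s zero    eq = ≡.refl
applyUpTo-range {f = f} s (suc n) eq = ≡.cong₂ _∷_
  (≡.trans (eq 0) (≡.cong f (ℕ.+-identityʳ s)))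
  (applyUpTo-range (suc s) n (λ i → ≡.trans (eq (suc i)) (≡.cong f (ℕ.+-suc s i))))

tabulate-toℕ : ∀ {C : Set} (f : ℕ → C) n → tabulate {n = n} (f ∘ toℕ) ≡ applyUpTo f n
tabulate-toℕ f zero    = ≡.refl
tabulate-toℕ f (suc n) = ≡.cong (f 0 ∷_) (tabulate-toℕ (f ∘ suc) n)

tabulate-range : ∀ {C : Set} (f : ℕ → C) s n → tabulate {n = n} (λ i → f (s ℕ.+ toℕ i)) ≡ map f (range s n)
tabulate-range f s n = ≡.trans (tabulate-toℕ (λ i → f (s ℕ.+ i)) n) (applyUpTo-range s n (λ _ → ≡.refl))

map-id-range : ∀ s n → map id (range s n) ≡ range s n
map-id-range s zero    = ≡.refl
map-id-range s (suc n) = ≡.cong (s ∷_) (map-id-range (suc s) n)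

atLeast-range : ∀ {Q : ℕ → Set} m k {N} → m ℕ.+ k ≤ N → (∀ {j} → m ≤ j → j < m ℕ.+ k → Q j) →
  AtLeast Q k (range 0 N)
atLeast-range {Q} m k m+k≤N q with ℕ.m≤n⇒∃[o]m+o≡n m+k≤N
... | r , ≡.refl = ≡.subst (AtLeast Q k) (≡.sym split)
  (atLeast-prepend (range 0 m) (≡.subst (λ n → AtLeast Q n (range m k ++ range (m ℕ.+ k) r)) (length-range m k)
    (atLeast-all (range (m ℕ.+ k) r)
      (All.zipWith (λ (m≤j , j<m+k) → q m≤j j<m+k) (range-lower m k , range-upper m k)))))
  where
  split : range 0 (m ℕ.+ k ℕ.+ r) ≡ range 0 m ++ (range m k ++ range (m ℕ.+ k) r)
  split = ≡.trans (≡.cong (range 0) (ℕ.+-assoc m k r))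
    (≡.trans (range-++ 0 m (k ℕ.+ r)) (≡.cong (range 0 m ++_) (range-++ m k r)))

nth-≥length : ∀ ks {i} → length ks ≤ i → nth ks i ≡ 0
nth-≥length []       _         = ≡.refl
nth-≥length (k ∷ ks) (s≤s len) = nth-≥length ks len

nth-step : ∀ {ks} → Linked _≥_ ks → ∀ i → nth ks (suc i) ≤ nth ks i
nth-step []          i       = z≤n
nth-step [-]         i       = z≤n
nth-step (k≥l ∷ dec) zero    = k≥l
nth-step (k≥l ∷ dec) (suc i) = nth-step dec i

⟨⟩-antitone : ∀ ν {i j} → i ≤ j → ν ⟨ j ⟩ ≤ ν ⟨ i ⟩
⟨⟩-antitone ν {i} i≤j with ℕ.m≤n⇒∃[o]m+o≡n i≤j
... | o , ≡.refl = go o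
  where
  go : ∀ o → ν ⟨ i ℕ.+ o ⟩ ≤ ν ⟨ i ⟩
  go zero    = ℕ.≤-reflexive (≡.cong (ν ⟨_⟩) (ℕ.+-identityʳ i))
  go (suc o) = ℕ.≤-trans
    (ℕ.≤-reflexive (≡.cong (ν ⟨_⟩) (ℕ.+-suc i o)))
    (ℕ.≤-trans (nth-step (decreasing ν) (i ℕ.+ o)) (go o))

prefix-length : ∀ {ks ls} → Prefix _≤_ ks ls → length ks ≤ length ls
prefix-length []      = z≤n
prefix-length (_ ∷ p) = s≤s (prefix-length p)

prefix-nth : ∀ {ks ls} → Prefix _≤_ ks ls → ∀ i → nth ks i ≤ nth ls i
prefix-nth []        i       = z≤n
prefix-nth (k≤l ∷ p) zero    = k≤l
prefix-nth (k≤l ∷ p) (suc i) = prefix-nth p i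

¬prefix : ∀ {ks} ls → All (0 <_) ks → ¬ Prefix _≤_ ks ls → ∃ λ i → i < length ks × nth ls i < nth ks i
¬prefix ls       []       ¬p = ⊥-elim (¬p [])
¬prefix []       (k>0 ∷ _) ¬p = 0 , z<s , k>0
¬prefix {k ∷ _} (l ∷ ls) (_ ∷ pos) ¬p with k ℕ.≤? l
... | no k≰l  = 0 , z<s , ℕ.≰⇒> k≰l
... | yes k≤l with ¬prefix ls pos (¬p ∘ (k≤l ∷_))
...   | i , i<len , lt = suc i , s<s i<len , lt

-- For a downward closed P the entries that pass form an initial segment, so counting them locates
-- the threshold. This converts `diagonal`, which is a count, into a comparison of i with νᵢ.
filter-initial : ∀ {P : ℕ → Set} (P? : Decidable P) → (∀ {i} → P (suc i) → P i) → ∀ s n →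
  let c = length (filter P? (range s n)) in
  c ≤ n × (∀ {i} → s ≤ i → i < s ℕ.+ c → P i) × (∀ {i} → s ℕ.+ c ≤ i → i < s ℕ.+ n → ¬ P i)
filter-initial P? closed s zero = z≤n ,
  (λ s≤i i<s → ⊥-elim (ℕ.<⇒≱ i<s (ℕ.≤-trans (ℕ.≤-reflexive (ℕ.+-identityʳ s)) s≤i))) ,
  (λ s≤i i<s → ⊥-elim (ℕ.<⇒≱ i<s s≤i))
filter-initial {P} P? closed s (suc n) with P? s | filter-initial P? closed (suc s) n
... | yes p | c≤n , below , above = s≤s c≤n , below′ , above′
  where
  c = length (filter P? (range (suc s) n))
  below′ : ∀ {i} → s ≤ i → i < s ℕ.+ suc c → P i
  below′ {i} s≤i i<s+c with ℕ.m≤n⇒m<n∨m≡n s≤i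
  ... | inj₁ s<i    = below s<i (≡.subst (i <_) (ℕ.+-suc s c) i<s+c)
  ... | inj₂ ≡.refl = p
  above′ : ∀ {i} → s ℕ.+ suc c ≤ i → i < s ℕ.+ suc n → ¬ P i
  above′ {i} s+c≤i i<s+n = above (≡.subst (_≤ i) (ℕ.+-suc s c) s+c≤i) (≡.subst (i <_) (ℕ.+-suc s n) i<s+n)
... | no ¬p | c≤n , below , above with length (filter P? (range (suc s) n))
-- A positive count further on would give P at `suc s`, and downward closure would then give it at
-- s.
...   | suc c = ⊥-elim (¬p (closed (below ℕ.≤-refl (s≤s (≡.subst (suc s ≤_) (≡.sym (ℕ.+-suc s c)) (s≤s (ℕ.m≤m+n s c)))))))
...   | zero  = z≤n ,
  (λ s≤i i<s → ⊥-elim (ℕ.<⇒≱ i<s (ℕ.≤-trans (ℕ.≤-reflexive (ℕ.+-identityʳ s)) s≤i))) ,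
  above′
  where
  above′ : ∀ {i} → s ℕ.+ 0 ≤ i → i < s ℕ.+ suc n → ¬ P i
  above′ {i} s≤i i<s+n with ℕ.m≤n⇒m<n∨m≡n (≡.subst (_≤ i) (ℕ.+-identityʳ s) s≤i)
  ... | inj₁ s<i    = above (≡.subst (_≤ i) (≡.sym (ℕ.+-identityʳ (suc s))) s<i) (≡.subst (i <_) (ℕ.+-suc s n) i<s+n)
  ... | inj₂ ≡.refl = ¬p

upTo≡range : ∀ n → upTo n ≡ range 0 n
upTo≡range n = ≡.trans (applyUpTo-range {f = id} 0 n (λ _ → ≡.refl)) (map-id-range 0 n)

module _ (ν : Partition) where
  private
    initial = filter-initial (λ i → i <? ν ⟨ i ⟩)
      (λ {i} lt → ℕ.<-≤-trans (ℕ.<-trans (ℕ.n<1+n i) lt) (nth-step (decreasing ν) i)) 0 (ℓ ν)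
    count : length (filter (λ i → i <? ν ⟨ i ⟩) (range 0 (ℓ ν))) ≡ diagonal ν
    count = ≡.cong (λ is → length (filter (λ i → i <? ν ⟨ i ⟩) is)) (≡.sym (upTo≡range (ℓ ν)))

  diagonal≤ℓ : diagonal ν ≤ ℓ ν
  diagonal≤ℓ = ≡.subst (_≤ ℓ ν) count (proj₁ initial)

  <diagonal : ∀ {i} → i < diagonal ν → i < ν ⟨ i ⟩
  <diagonal i<d = proj₁ (proj₂ initial) z≤n (≡.subst (_ <_) (≡.sym count) i<d)

  ≥diagonal : ∀ {i} → diagonal ν ≤ i → ν ⟨ i ⟩ ≤ i
  ≥diagonal {i} d≤i with i <? ℓ ν
  ... | yes i<ℓ = ℕ.≮⇒≥ (proj₂ (proj₂ initial) (≡.subst (_≤ i) (≡.sym count) d≤i) i<ℓ)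
  ... | no i≮ℓ  = ℕ.≤-trans (ℕ.≤-reflexive (nth-≥length (parts ν) (ℕ.≮⇒≥ i≮ℓ))) z≤n

-- As a difference of two naturals the index has its sign decided by comparing them.
index≡⊖ : ∀ k l i j → + k ℤ.- + l ℤ.- + i ℤ.+ + j ≡ (k ℕ.+ j) ⊖ (l ℕ.+ i)
index≡⊖ k l i j = begin
  + k ℤ.- + l ℤ.- + i ℤ.+ + j        ≡⟨ solve 4 (λ k l i j → k :- l :- i :+ j := (k :+ j) :- (l :+ i)) ≡.refl (+ k) (+ l) (+ i) (+ j) ⟩
  (+ k ℤ.+ + j) ℤ.- (+ l ℤ.+ + i)    ≡⟨ ≡.cong₂ ℤ._-_ (ℤ.pos-+ k j) (ℤ.pos-+ l i) ⟨
  + (k ℕ.+ j) ℤ.- + (l ℕ.+ i)        ≡⟨ ℤ.m-n≡m⊖n (k ℕ.+ j) (l ℕ.+ i) ⟩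
  (k ℕ.+ j) ⊖ (l ℕ.+ i)              ∎
  where open ≡-Reasoning; open ℤ.+-*-Solver

-- The staircase offsets contribute i and j, and N cancels. This is why the expansion coefficients
-- do not depend on the number of variables.
exponent-difference : ∀ {N} k l {i j} → i < N → j < N →
  (k ℕ.+ (N ∸ suc i)) ⊖ (l ℕ.+ (N ∸ suc j)) ≡ (k ℕ.+ j) ⊖ (l ℕ.+ i)
exponent-difference {suc N} k l {i} {j} (s≤s i≤N) (s≤s j≤N) = begin
  (k ℕ.+ (N ∸ i)) ⊖ (l ℕ.+ (N ∸ j))
    ≡⟨ ℤ.+-cancelˡ-⊖ (i ℕ.+ j) _ _ ⟨
  (i ℕ.+ j ℕ.+ (k ℕ.+ (N ∸ i))) ⊖ (i ℕ.+ j ℕ.+ (l ℕ.+ (N ∸ j)))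
    ≡⟨ ≡.cong₂ _⊖_
      (solve 4 (λ i j k r → i :+ j :+ (k :+ r) := (r :+ i) :+ (k :+ j)) ≡.refl i j k (N ∸ i))
      (solve 4 (λ i j l r → i :+ j :+ (l :+ r) := (r :+ j) :+ (l :+ i)) ≡.refl i j l (N ∸ j)) ⟩
  ((N ∸ i ℕ.+ i) ℕ.+ (k ℕ.+ j)) ⊖ ((N ∸ j ℕ.+ j) ℕ.+ (l ℕ.+ i))
    ≡⟨ ≡.cong₂ (λ s t → (s ℕ.+ (k ℕ.+ j)) ⊖ (t ℕ.+ (l ℕ.+ i))) (ℕ.m∸n+n≡m i≤N) (ℕ.m∸n+n≡m j≤N) ⟩
  (N ℕ.+ (k ℕ.+ j)) ⊖ (N ℕ.+ (l ℕ.+ i))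
    ≡⟨ ℤ.+-cancelˡ-⊖ N _ _ ⟩
  (k ℕ.+ j) ⊖ (l ℕ.+ i) ∎
  where open ≡-Reasoning; open +-*-Solver

⊖-negative : ∀ {p q} → p < q → ∃ λ k → p ⊖ q ≡ -[1+ k ]
⊖-negative {p} {q} p<q with q ∸ p | ℕ.m<n⇒0<n∸m p<q | ℤ.⊖-< p<q
... | suc k | _ | eq = k , eq

-- The coefficient determinant: zero blocks and block factorisation

module Coefficients (K : CommutativeRing 0ℓ 0ℓ) (aᵢ : ℤ → CommutativeRing.Carrier K) where

  open CommutativeRing K hiding (zero)
  open RingOperations rawRing using (_^_; ∑; ∏; det; h; e)
  open RingProperties ring
  open Determinants K
  open Sums K
  open SeriesProperties K
  open SetoidReasoning setoid
  private
    module S = Schur rawRing aᵢ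
    module * = CommutativeSemigroupProperties (CommutativeRing.*-commutativeSemigroup K)

  e-vanish : ∀ ys {k} → length ys < k → e (+ k) ys ≈ 0#
  e-vanish ys {k} len = reflexive (≡.cong (λ zs → ∑ (map ∏ zs)) (subsets-vanish ys len))
    where
    subsets-vanish : ∀ (ys : List Carrier) {k} → length ys < k → subsets k ys ≡ []
    subsets-vanish []       {suc k} _         = ≡.refl
    subsets-vanish (y ∷ ys) {suc k} (s≤s len) = ≡.cong₂ (λ l l′ → map (y ∷_) l ++ l′)
      (subsets-vanish ys len) (subsets-vanish ys (ℕ.m<n⇒m<1+n len))

  -1^-+ : ∀ m n → (- 1#) ^ (m ℕ.+ n) ≈ (- 1#) ^ m * (- 1#) ^ n
  -1^-+ zero    n = sym (*-identityˡ _)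
  -1^-+ (suc m) n = trans (*-congˡ (-1^-+ m n)) (sym (*-assoc _ _ _))

  -1^-double : ∀ n → (- 1#) ^ (n ℕ.+ n) ≈ 1#
  -1^-double zero    = refl
  -1^-double (suc n) = begin
    - 1# * (- 1#) ^ (n ℕ.+ suc n)          ≡⟨ ≡.cong (λ m → - 1# * (- 1#) ^ m) (ℕ.+-suc n n) ⟩
    - 1# * (- 1# * (- 1#) ^ (n ℕ.+ n))     ≈⟨ *-congˡ (*-congˡ (-1^-double n)) ⟩
    - 1# * (- 1# * 1#)                     ≈⟨ *-congˡ (*-identityʳ _) ⟩
    - 1# * - 1#                            ≈⟨ -1*x≈-x _ ⟩
    - - 1#                                 ≈⟨ -‿involutive _ ⟩
    1#                                     ∎

  -1^-parity : ∀ {m} n k → m ≡ n ℕ.+ (k ℕ.+ k) → (- 1#) ^ m ≈ (- 1#) ^ n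
  -1^-parity n k ≡.refl = trans (-1^-+ n (k ℕ.+ k)) (trans (*-congˡ (-1^-double k)) (*-identityʳ _))

  signedEℤ : ℤ → List Carrier → Carrier
  signedEℤ (+ k)    ys = signedE ys k
  signedEℤ -[1+ _ ] ys = 0#

  module _ (μ : Partition) where
    private d = diagonal μ

    columnH columnE : ℕ → List Carrier
    columnH j = S.a₀,a₋₁,⋯ (μ ⟨ j ⟩ ∸ j)
    columnE j = S.a₁,a₂,⋯ (j ∸ μ ⟨ j ⟩)

    weight : ℤ → ℕ → Carrier
    weight z j = if does (j <? d) then h z (columnH j) else signedEℤ z (columnE j)

    weight-< : ∀ z {j} → j < d → weight z j ≡ h z (columnH j)
    weight-< z {j} j<d = if-yes (j <? d) j<d

    weight-≥ : ∀ z {j} → d ≤ j → weight z j ≡ signedEℤ z (columnE j)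
    weight-≥ z {j} d≤j = if-no (j <? d) (ℕ.≤⇒≯ d≤j)

    weight-negative : ∀ k j → weight -[1+ k ] j ≈ 0#
    weight-negative k j with does (j <? d)
    ... | true  = refl
    ... | false = refl

    module _ (ν : Partition) where

      entry : ℕ → ℕ → Carrier
      entry i j = weight (S.index ν μ i j) j

      entry-low : ∀ {i j} → ν ⟨ i ⟩ ℕ.+ j < μ ⟨ j ⟩ ℕ.+ i → entry i j ≈ 0#
      entry-low {i} {j} lt with ⊖-negative lt
      ... | k , eq = trans
        (reflexive (≡.cong (λ z → weight z j) (≡.trans (index≡⊖ (ν ⟨ i ⟩) (μ ⟨ j ⟩) i j) eq)))
        (weight-negative k j)

      -- From i < νᵢ the degree νᵢ - μⱼ - i + j is at least j - μⱼ + 1, one more than the number of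
      -- variables of e in column j.
      entry-right : ∀ {i j} → d ≤ j → i < ν ⟨ i ⟩ → entry i j ≈ 0#
      entry-right {i} {j} d≤j i<νᵢ = begin
        weight (S.index ν μ i j) j
          ≡⟨ ≡.cong (λ z → weight z j) (≡.trans (index≡⊖ (ν ⟨ i ⟩) μⱼ i j) (ℤ.⊖-≥ (ℕ.≤-trans (ℕ.n≤1+n _) q<p))) ⟩
        weight (+ (p ∸ q)) j
          ≡⟨ weight-≥ (+ (p ∸ q)) d≤j ⟩
        (- 1#) ^ (p ∸ q) * e (+ (p ∸ q)) (columnE j)
          ≈⟨ x*0≈0 (e-vanish (columnE j) (≡.subst (_< p ∸ q) (≡.sym length-columnE) enough)) ⟩
        0# ∎
        where
        μⱼ = μ ⟨ j ⟩
        p = ν ⟨ i ⟩ ℕ.+ j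
        q = μⱼ ℕ.+ i
        length-columnE : length (columnE j) ≡ j ∸ μⱼ
        length-columnE = ≡.trans (length-map _ (upTo (j ∸ μⱼ))) (length-upTo (j ∸ μⱼ))
        enough′ : suc (j ∸ μⱼ) ℕ.+ q ≤ p
        enough′ = ≡.subst (_≤ p)
          (≡.trans (≡.cong (suc i ℕ.+_) (≡.sym (ℕ.m∸n+n≡m (≥diagonal μ d≤j))))
            (solve 3 (λ i r m → con 1 :+ i :+ (r :+ m) := con 1 :+ r :+ (m :+ i)) ≡.refl i (j ∸ μⱼ) μⱼ))
          (ℕ.+-monoˡ-≤ j i<νᵢ)
          where open +-*-Solver
        q<p : q < p
        q<p = ℕ.≤-trans (s≤s (ℕ.m≤n+m q (j ∸ μⱼ))) enough′
        enough : j ∸ μⱼ < p ∸ q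
        enough = ℕ.m+n≤o⇒m≤o∸n (suc (j ∸ μⱼ)) enough′

      -- Here νᵢ - i ≤ 0 < μⱼ - j, so the index is negative.
      entry-left : ∀ {i j} → j < d → ν ⟨ i ⟩ ≤ i → entry i j ≈ 0#
      entry-left {i} {j} j<d νᵢ≤i = entry-low (≡.subst (ν ⟨ i ⟩ ℕ.+ j <_) (ℕ.+-comm i (μ ⟨ j ⟩))
        (ℕ.+-mono-≤-< νᵢ≤i (<diagonal μ j<d)))

      coefficient : ℕ → Carrier
      coefficient N = Det (map entry (range 0 N)) (range 0 N)

      -- Let νᵢ < μᵢ. By monotonicity of the parts, the rows from i on vanish in the columns up to
      -- i: a zero block of N - i rows and i + 1 columns, one too many in total.
      coefficient-⊈ : ∀ {N} → ℓ μ ≤ N → ¬ μ ⊆ ν → coefficient N ≈ 0#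
      coefficient-⊈ {N} ℓ≤N μ⊈ν with ¬prefix (parts ν) (positive μ) μ⊈ν
      ... | i , i<ℓ , νᵢ<μᵢ with ℕ.m≤n⇒∃[o]m+o≡n (ℕ.≤-trans (ℕ.<⇒≤ i<ℓ) ℓ≤N)
      ...   | r , ≡.refl = begin
        Det (map entry (range 0 (i ℕ.+ r))) cs
          ≡⟨ ≡.cong (λ is → Det is cs) (≡.trans (≡.cong (map entry) (range-++ 0 i r)) (map-++ entry (range 0 i) (range i r))) ⟩
        Det (map entry (range 0 i) ++ map entry (range i r)) cs
          ≈⟨ Det-vanish {Q = _≤ i} (map entry (range 0 i))
               (All.map⁺ (All.map kill (range-lower i r)))
               (≡.subst (λ n → AtLeast (_≤ i) (suc n) cs)
                 (≡.sym (≡.trans (length-map entry (range 0 i)) (length-range 0 i)))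
                 (atLeast-range 0 (suc i) (ℕ.≤-trans i<ℓ ℓ≤N) (λ _ → s≤s⁻¹))) ⟩
        0# ∎
        where
        cs = range 0 (i ℕ.+ r)
        kill : ∀ {i′} → i ≤ i′ → ∀ {j} → j ≤ i → entry i′ j ≈ 0#
        kill i≤i′ j≤i = entry-low (ℕ.+-mono-<-≤
          (ℕ.≤-<-trans (⟨⟩-antitone ν i≤i′) (ℕ.<-≤-trans νᵢ<μᵢ (⟨⟩-antitone μ j≤i)))
          (ℕ.≤-trans j≤i i≤i′))

      -- If ν has fewer than d diagonal boxes, too many rows vanish in the first d columns by
      -- `entry-left`; if it has more, too many rows vanish in the remaining columns by
      -- `entry-right`.
      coefficient-diagonal : ∀ {N} → ℓ μ ≤ N → ℓ ν ≤ N → diagonal ν ≢ d → coefficient N ≈ 0#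
      coefficient-diagonal {N} ℓμ≤N ℓν≤N δ≢d with ℕ.m≤n⇒∃[o]m+o≡n (ℕ.≤-trans (diagonal≤ℓ ν) ℓν≤N)
      ... | r , ≡.refl = trans
        (reflexive (≡.cong (λ is → Det is cs) (≡.trans (≡.cong (map entry) (range-++ 0 δ r)) (map-++ entry (range 0 δ) (range δ r)))))
        vanish
        where
        δ  = diagonal ν
        cs = range 0 (δ ℕ.+ r)
        d≤N : d ≤ δ ℕ.+ r
        d≤N = ℕ.≤-trans (diagonal≤ℓ μ) ℓμ≤N
        length-rows : ∀ s n → length (map entry (range s n)) ≡ n
        length-rows s n = ≡.trans (length-map entry (range s n)) (length-range s n)
        below : ∀ {i} → δ ≤ i → ∀ {j} → j < d → entry i j ≈ 0#
        below δ≤i j<d = entry-left j<d (≥diagonal ν δ≤i)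
        above : ∀ {i} → i < δ → ∀ {j} → d ≤ j → entry i j ≈ 0#
        above i<δ d≤j = entry-right d≤j (<diagonal ν i<δ)
        vanish : Det (map entry (range 0 δ) ++ map entry (range δ r)) cs ≈ 0#
        vanish with ℕ.<-cmp δ d
        ... | tri≈ _ δ≡d _ = ⊥-elim (δ≢d δ≡d)
        ... | tri< δ<d _ _ = Det-vanish {Q = _< d} (map entry (range 0 δ))
          (All.map⁺ (All.map below (range-lower δ r)))
          (≡.subst (λ n → AtLeast (_< d) (suc n) cs) (≡.sym (length-rows 0 δ))
            (atLeast-range 0 (suc δ) (ℕ.≤-trans δ<d d≤N) (λ _ j≤δ → ℕ.≤-trans j≤δ δ<d)))
        ... | tri> _ _ d<δ = Det-vanish′ {Q = d ≤_} (map entry (range δ r))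
          (All.map⁺ (All.map above (range-upper 0 δ)))
          (≡.subst (λ n → AtLeast (d ≤_) (suc n) cs) (≡.sym (length-rows δ r))
            (atLeast-range d (suc r) (≡.subst (_≤ δ ℕ.+ r) (≡.sym (ℕ.+-suc d r)) (ℕ.+-monoˡ-≤ r d<δ))
              (λ d≤j _ → d≤j)))

      module Blocks {N} (ℓν≤N : ℓ ν ≤ N) (μ⊆ν : μ ⊆ ν) (δ≡d : diagonal ν ≡ d) where

        d≤ℓν : d ≤ ℓ ν
        d≤ℓν = ≡.subst (_≤ ℓ ν) δ≡d (diagonal≤ℓ ν)

        p q : ℕ
        p = ℓ ν ∸ d
        q = N ∸ ℓ ν

        d+p≡ℓ : d ℕ.+ p ≡ ℓ ν
        d+p≡ℓ = ℕ.m+[n∸m]≡n d≤ℓν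

        N≡d+p+q : N ≡ d ℕ.+ (p ℕ.+ q)
        N≡d+p+q = ≡.sym (≡.trans (≡.sym (ℕ.+-assoc d p q))
          (≡.trans (≡.cong (ℕ._+ q) d+p≡ℓ) (ℕ.m+[n∸m]≡n ℓν≤N)))

        length-block : ∀ s n → length (map entry (range s n)) ≡ length (range s n)
        length-block s n = length-map entry (range s n)

        Det-H : Det (map entry (range 0 d)) (range 0 d) ≈ det λ (i j : Fin d) →
          h (S.index ν μ (toℕ i) (toℕ j)) (columnH (toℕ j))
        Det-H = sym (begin
          det (λ (i j : Fin d) → H (toℕ i) (toℕ j))
            ≈⟨ det≈Det {n = d} (H ∘ toℕ) toℕ ⟩
          Det (tabulate {n = d} (H ∘ toℕ)) (tabulate {n = d} toℕ)
            ≡⟨ ≡.cong₂ Det (tabulate-range H 0 d) (≡.trans (tabulate-range id 0 d) (map-id-range 0 d)) ⟩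
          Det (map H (range 0 d)) (range 0 d)
            ≈⟨ Det-cong (range-upper 0 d) (pointwise (range 0 d)) ⟩
          Det (map entry (range 0 d)) (range 0 d) ∎)
          where
          H : ℕ → ℕ → Carrier
          H i j = h (S.index ν μ i j) (columnH j)
          pointwise : ∀ is → Pointwise (λ r r′ → ∀ {j} → j < d → r j ≈ r′ j) (map H is) (map entry is)
          pointwise []       = []
          pointwise (i ∷ is) = (λ {j} j<d → sym (reflexive (weight-< (S.index ν μ i j) j<d))) ∷ pointwise is

        E : ℕ → ℕ → Carrier
        E i j = e (S.index ν μ i j) (columnE j)

        -- The sign with exponent νᵢ - μⱼ - i + j splits into a row factor and a column factor. Only
        -- parity matters, so all four terms are added.
        rowSign columnSign : ℕ → Carrier
        rowSign    i = (- 1#) ^ (ν ⟨ i ⟩ ℕ.+ i)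
        columnSign j = (- 1#) ^ (μ ⟨ j ⟩ ℕ.+ j)

        sign-entry : ∀ i j → signedEℤ (S.index ν μ i j) (columnE j) ≈ rowSign i * (E i j * columnSign j)
        sign-entry i j rewrite index≡⊖ (ν ⟨ i ⟩) (μ ⟨ j ⟩) i j
          with ℕ.<-≤-connex (ν ⟨ i ⟩ ℕ.+ j) (μ ⟨ j ⟩ ℕ.+ i)
        ... | inj₁ lt with ⊖-negative lt
        ...   | k , eq rewrite eq = sym (x*0≈0 (zeroˡ _))
        sign-entry i j | inj₂ le rewrite ℤ.⊖-≥ le = begin
          (- 1#) ^ k * e (+ k) (columnE j)
            ≈⟨ *-congʳ (trans (sym (-1^-parity k (μ ⟨ j ⟩ ℕ.+ i) parity)) (-1^-+ (ν ⟨ i ⟩ ℕ.+ i) (μ ⟨ j ⟩ ℕ.+ j))) ⟩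
          (rowSign i * columnSign j) * e (+ k) (columnE j)
            ≈⟨ *-assoc _ _ _ ⟩
          rowSign i * (columnSign j * e (+ k) (columnE j))
            ≈⟨ *-congˡ (*-comm _ _) ⟩
          rowSign i * (e (+ k) (columnE j) * columnSign j) ∎
          where
          k = (ν ⟨ i ⟩ ℕ.+ j) ∸ (μ ⟨ j ⟩ ℕ.+ i)
          parity : (ν ⟨ i ⟩ ℕ.+ i) ℕ.+ (μ ⟨ j ⟩ ℕ.+ j) ≡ k ℕ.+ ((μ ⟨ j ⟩ ℕ.+ i) ℕ.+ (μ ⟨ j ⟩ ℕ.+ i))
          parity = ≡.trans
            (solve 4 (λ k i l j → (k :+ i) :+ (l :+ j) := (k :+ j) :+ (l :+ i)) ≡.refl (ν ⟨ i ⟩) i (μ ⟨ j ⟩) j)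
            (≡.trans (≡.cong (ℕ._+ (μ ⟨ j ⟩ ℕ.+ i)) (≡.sym (ℕ.m∸n+n≡m le))) (ℕ.+-assoc k _ _))
            where open +-*-Solver

        -- Row i is paired with column i, leaving the parity of νᵢ - μᵢ; the containment of μ in ν
        -- makes this subtraction exact. Over the rows from d to ℓ(ν) it yields the sign in the
        -- theorem.
        ∏-signs : ∀ is → ∏ (map rowSign is) * ∏ (map columnSign is) ≈
          (- 1#) ^ ℕ.sum (map (λ i → ν ⟨ i ⟩ ∸ μ ⟨ i ⟩) is)
        ∏-signs []       = *-identityˡ _
        ∏-signs (i ∷ is) = begin
          (rowSign i * ∏ (map rowSign is)) * (columnSign i * ∏ (map columnSign is))
            ≈⟨ *.interchange _ _ _ _ ⟩
          (rowSign i * columnSign i) * (∏ (map rowSign is) * ∏ (map columnSign is))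
            ≈⟨ *-cong (trans (sym (-1^-+ (ν ⟨ i ⟩ ℕ.+ i) (μ ⟨ i ⟩ ℕ.+ i))) (-1^-parity k (μ ⟨ i ⟩ ℕ.+ i) parity)) (∏-signs is) ⟩
          (- 1#) ^ k * (- 1#) ^ ℕ.sum (map (λ i → ν ⟨ i ⟩ ∸ μ ⟨ i ⟩) is)
            ≈⟨ -1^-+ k _ ⟨
          (- 1#) ^ ℕ.sum (map (λ i → ν ⟨ i ⟩ ∸ μ ⟨ i ⟩) (i ∷ is)) ∎
          where
          k = ν ⟨ i ⟩ ∸ μ ⟨ i ⟩
          parity : (ν ⟨ i ⟩ ℕ.+ i) ℕ.+ (μ ⟨ i ⟩ ℕ.+ i) ≡ k ℕ.+ ((μ ⟨ i ⟩ ℕ.+ i) ℕ.+ (μ ⟨ i ⟩ ℕ.+ i))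
          parity = ≡.trans
            (≡.cong (λ n → (n ℕ.+ i) ℕ.+ (μ ⟨ i ⟩ ℕ.+ i)) (≡.sym (ℕ.m∸n+n≡m (prefix-nth μ⊆ν i))))
            (solve 3 (λ k l i → (k :+ l :+ i) :+ (l :+ i) := k :+ ((l :+ i) :+ (l :+ i))) ≡.refl k (μ ⟨ i ⟩) i)
            where open +-*-Solver

        Det-E : Det (map entry (range d p)) (range d p) ≈ (- 1#) ^ S.boxesBelow d ν μ * det λ (i j : Fin p) →
          e (S.index ν μ (d ℕ.+ toℕ i) (d ℕ.+ toℕ j)) (columnE (d ℕ.+ toℕ j))
        Det-E = begin
          Det (map entry R) R
            ≈⟨ Det-cong (range-lower d p) (pointwise R) ⟩
          Det (map (λ i j → signedEℤ (S.index ν μ i j) (columnE j)) R) R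
            ≈⟨ Det-scale E _ rowSign columnSign sign-entry R R ⟩
          ∏ (map rowSign R) * (Det (map E R) R * ∏ (map columnSign R))
            ≈⟨ trans (*-congˡ (*-comm _ _)) (sym (*-assoc _ _ _)) ⟩
          (∏ (map rowSign R) * ∏ (map columnSign R)) * Det (map E R) R
            ≈⟨ *-congʳ (∏-signs R) ⟩
          (- 1#) ^ ℕ.sum (map (λ i → ν ⟨ i ⟩ ∸ μ ⟨ i ⟩) R) * Det (map E R) R
            ≈⟨ *-cong (reflexive (≡.cong (λ is → (- 1#) ^ ℕ.sum is) (≡.sym boxes)))
                 (trans (reflexive (≡.sym (≡.cong₂ Det (tabulate-range E d p)
                   (≡.trans (tabulate-range id d p) (map-id-range d p)))))
                   (sym (det≈Det {n = p} (λ i → E (d ℕ.+ toℕ i)) (λ j → d ℕ.+ toℕ j)))) ⟩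
          (- 1#) ^ S.boxesBelow d ν μ * det (λ (i j : Fin p) → E (d ℕ.+ toℕ i) (d ℕ.+ toℕ j)) ∎
          where
          R = range d p
          boxes : map (λ i → ν ⟨ d ℕ.+ i ⟩ ∸ μ ⟨ d ℕ.+ i ⟩) (upTo p) ≡ map (λ i → ν ⟨ i ⟩ ∸ μ ⟨ i ⟩) R
          boxes = ≡.trans (map-applyUpTo id _ p) (applyUpTo-range d p (λ _ → ≡.refl))
          pointwise : ∀ is → Pointwise (λ r r′ → ∀ {j} → d ≤ j → r j ≈ r′ j)
            (map entry is) (map (λ i j → signedEℤ (S.index ν μ i j) (columnE j)) is)
          pointwise []       = []
          pointwise (i ∷ is) = (λ {j} d≤j → reflexive (weight-≥ (S.index ν μ i j) d≤j)) ∷ pointwise is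

        νᵢ≡0 : ∀ {i} → ℓ ν ≤ i → ν ⟨ i ⟩ ≡ 0
        νᵢ≡0 = nth-≥length (parts ν)

        entry-below : ∀ {i j} → ℓ ν ≤ i → j < i → entry i j ≈ 0#
        entry-below {i} {j} ℓ≤i j<i = entry-low (≡.subst (λ k → k ℕ.+ j < μ ⟨ j ⟩ ℕ.+ i) (≡.sym (νᵢ≡0 ℓ≤i))
          (ℕ.<-≤-trans j<i (ℕ.m≤n+m i (μ ⟨ j ⟩))))

        entry-diagonal : ∀ {i} → ℓ ν ≤ i → entry i i ≈ 1#
        entry-diagonal {i} ℓ≤i = begin
          weight (S.index ν μ i i) i
            ≡⟨ ≡.cong (λ z → weight z i) (≡.trans (index≡⊖ (ν ⟨ i ⟩) (μ ⟨ i ⟩) i i)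
                (≡.cong₂ (λ k l → (k ℕ.+ i) ⊖ (l ℕ.+ i)) (νᵢ≡0 ℓ≤i)
                  (nth-≥length (parts μ) (ℕ.≤-trans (prefix-length μ⊆ν) ℓ≤i)))) ⟩
          weight (i ⊖ i) i
            ≡⟨ ≡.cong (λ z → weight z i) (ℤ.n⊖n≡0 i) ⟩
          weight (+ 0) i
            ≡⟨ weight-≥ (+ 0) (ℕ.≤-trans d≤ℓν ℓ≤i) ⟩
          -- The unfolded `signedE` in degree 0: sign 1 times the sum whose only term is the empty
          -- product.
          1# * (1# + 0#)
            ≈⟨ trans (*-identityˡ _) (+-identityʳ _) ⟩
          1# ∎

        Det-unitriangular : ∀ s n → ℓ ν ≤ s → Det (map entry (range s n)) (range s n) ≈ 1#
        Det-unitriangular s zero    ℓ≤s = refl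
        Det-unitriangular s (suc n) ℓ≤s = trans
          (Det-∷ (entry-diagonal ℓ≤s)
            (All.map⁺ (All.map (λ s<i → entry-below (ℕ.≤-trans ℓ≤s (ℕ.<⇒≤ s<i)) s<i) (range-lower (suc s) n))))
          (Det-unitriangular (suc s) n (ℕ.m≤n⇒m≤1+n ℓ≤s))

        map-split : ∀ s m n → map entry (range s (m ℕ.+ n)) ≡ map entry (range s m) ++ map entry (range (s ℕ.+ m) n)
        map-split s m n = ≡.trans (≡.cong (map entry) (range-++ s m n)) (map-++ entry (range s m) _)

        -- The two cuts use opposite zero blocks. At d the upper rows vanish to the right, where the
        -- degree exceeds the number of variables; at ℓ(ν) the lower rows vanish to the left, where
        -- the index is negative.
        coefficient-blocks : coefficient N ≈
          Det (map entry (range 0 d)) (range 0 d) * Det (map entry (range d p)) (range d p)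
        coefficient-blocks = begin
          coefficient N
            ≡⟨ ≡.cong coefficient N≡d+p+q ⟩
          coefficient (d ℕ.+ (p ℕ.+ q))
            ≡⟨ ≡.cong₂ Det (map-split 0 d (p ℕ.+ q)) (range-++ 0 d (p ℕ.+ q)) ⟩
          Det (map entry (range 0 d) ++ map entry (range d (p ℕ.+ q))) (range 0 d ++ range d (p ℕ.+ q))
            ≈⟨ Det-lower (map entry (range 0 d)) (map entry (range d (p ℕ.+ q))) (range 0 d) (range d (p ℕ.+ q)) (length-block 0 d)
                 (All.map⁺ (All.map right (range-upper 0 d))) ⟩
          Det (map entry (range 0 d)) (range 0 d) * Det (map entry (range d (p ℕ.+ q))) (range d (p ℕ.+ q))
            ≈⟨ *-congˡ (begin
              Det (map entry (range d (p ℕ.+ q))) (range d (p ℕ.+ q))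
                ≡⟨ ≡.cong₂ Det (map-split d p q) (range-++ d p q) ⟩
              Det (map entry (range d p) ++ map entry (range (d ℕ.+ p) q)) (range d p ++ range (d ℕ.+ p) q)
                ≈⟨ Det-upper (map entry (range d p)) (map entry (range (d ℕ.+ p) q)) (range (d ℕ.+ p) q) (length-block d p)
                     (range-upper d p) (All.map⁺ (All.map below (range-lower (d ℕ.+ p) q))) ⟩
              Det (map entry (range d p)) (range d p) * Det (map entry (range (d ℕ.+ p) q)) (range (d ℕ.+ p) q)
                ≈⟨ *-congˡ (Det-unitriangular (d ℕ.+ p) q (ℕ.≤-reflexive (≡.sym d+p≡ℓ))) ⟩
              Det (map entry (range d p)) (range d p) * 1#
                ≈⟨ *-identityʳ _ ⟩
              Det (map entry (range d p)) (range d p) ∎) ⟩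
          Det (map entry (range 0 d)) (range 0 d) * Det (map entry (range d p)) (range d p) ∎
          where
          right : ∀ {i} → i < d → All (λ j → entry i j ≈ 0#) (range d (p ℕ.+ q))
          right i<d = All.map (λ d≤j → entry-right d≤j (<diagonal ν (≡.subst (_ <_) (≡.sym δ≡d) i<d))) (range-lower d (p ℕ.+ q))
          below : ∀ {i} → d ℕ.+ p ≤ i → ∀ {j} → j < d ℕ.+ p → entry i j ≈ 0#
          below ℓ≤i j<ℓ = entry-below (≡.subst (_≤ _) d+p≡ℓ ℓ≤i) (ℕ.<-≤-trans j<ℓ ℓ≤i)

      expansion≡0 : ¬ (μ ⊆ ν × diagonal ν ≡ d) → S.expansion μ ν ≡ 0#
      expansion≡0 = if-no (μ ⊆? ν ×-dec diagonal ν ≟ d)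

      -- The left side does not involve N, so this contains the stability of `coefficient` once N
      -- bounds both lengths.
      expansion≈coefficient : ∀ {N} → ℓ μ ≤ N → ℓ ν ≤ N → S.expansion μ ν ≈ coefficient N
      expansion≈coefficient {N} ℓμ≤N ℓν≤N = cases (μ ⊆? ν) (diagonal ν ≟ d)
        where
        cases : Dec (μ ⊆ ν) → Dec (diagonal ν ≡ d) → S.expansion μ ν ≈ coefficient N
        cases (no μ⊈ν)  _         = trans (reflexive (expansion≡0 (μ⊈ν ∘ proj₁))) (sym (coefficient-⊈ ℓμ≤N μ⊈ν))
        cases (yes μ⊆ν) (no δ≢d)  = trans (reflexive (expansion≡0 (δ≢d ∘ proj₂))) (sym (coefficient-diagonal ℓμ≤N ℓν≤N δ≢d))
        cases (yes μ⊆ν) (yes δ≡d) = trans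
          (reflexive (if-yes (μ ⊆? ν ×-dec diagonal ν ≟ d) (μ⊆ν , δ≡d)))
          (sym (trans coefficient-blocks (trans (*-cong Det-H Det-E) (*.x∙yz≈yx∙z _ _ _))))
          where open Blocks ℓν≤N μ⊆ν δ≡d

-- The expansion in N variables

sum-toList : ∀ {N} (α : Vec ℕ N) → ℕ.sum (toList α) ≡ Vec.sum α
sum-toList []      = ≡.refl
sum-toList (k ∷ α) = ≡.cong (k ℕ.+_) (sum-toList α)

length-swap : ∀ (xs : List ℕ) {b c ys} → length (xs ++ b ∷ c ∷ ys) ≡ length (xs ++ c ∷ b ∷ ys)
length-swap []       = ≡.refl
length-swap (x ∷ xs) = ≡.cong suc (length-swap xs)

sum-swap : ∀ xs b c ys → ℕ.sum (xs ++ b ∷ c ∷ ys) ≡ ℕ.sum (xs ++ c ∷ b ∷ ys)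
sum-swap []       b c ys = ≡.trans (≡.sym (ℕ.+-assoc b c _))
  (≡.trans (≡.cong (ℕ._+ ℕ.sum ys) (ℕ.+-comm b c)) (ℕ.+-assoc c b _))
sum-swap (x ∷ xs) b c ys = ≡.cong (x ℕ.+_) (sum-swap xs b c ys)

module Expansion (K : CommutativeRing 0ℓ 0ℓ) (aᵢ : ℤ → CommutativeRing.Carrier K) where

  open CommutativeRing K hiding (zero)
  open RingOperations rawRing using (∑; h)
  open RingProperties ring
  open Determinants K
  open Sorting K
  open Sums K
  open SeriesProperties K
  open Division K
  open PartitionSums K
  open Coefficients K aᵢ
  open SetoidReasoning setoid
  private
    module S = Schur rawRing aᵢ

  δ-sym : ∀ b c → δ b c ≈ δ c b
  δ-sym zero    zero    = refl
  δ-sym zero    (suc c) = refl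
  δ-sym (suc b) zero    = refl
  δ-sym (suc b) (suc c) = δ-sym b c

  -- Multiplication by x^m shifts the index. Since w vanishes at negative integers, one formula also
  -- covers the exponents below m.
  shift-⊖ : ∀ (w : ℤ → Carrier) → (∀ k → w -[1+ k ] ≈ 0#) → ∀ m b → shift m (λ k → w (+ k)) b ≈ w (b ⊖ m)
  shift-⊖ w w≈0 zero    b       = refl
  shift-⊖ w w≈0 (suc m) zero    = sym (w≈0 m)
  shift-⊖ w w≈0 (suc m) (suc b) = trans (shift-⊖ w w≈0 m b) (reflexive (≡.cong w (≡.sym (ℤ.[1+m]⊖[1+n]≡m⊖n b m))))

  module _ (N : ℕ) where
    open PowerSeries rawRing N using (Series; inVariable; x; constant; geometric; _/Vandermonde) renaming (rawRing to seriesRing; det to detₛ; _^_ to _^ₛ_; ∏ to ∏ₛ)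
    private module SR = RawRing seriesRing

    -- This and `dualMatrix` restate the matrices local to `schurPolynomial` and `dualSchurSeries`,
    -- so that lemmas can name them.
    schurMatrix : Partition → Fin N → Fin N → Series
    schurMatrix ν i j = x i ^ₛ (ν ⟨ toℕ j ⟩ ℕ.+ (N ∸ suc (toℕ j)))

    dualMatrix : Partition → Fin N → Fin N → Series
    dualMatrix μ i j = SR._*_ (x i ^ₛ (μ ⟨ toℕ j ⟩ ℕ.+ (N ∸ suc (toℕ j))))
      (if does (toℕ j <? diagonal μ)
       then ∏ₛ (map (λ c → geometric c i) (S.a₀,a₋₁,⋯ (μ ⟨ toℕ j ⟩ ∸ toℕ j)))
       else ∏ₛ (map (λ c → SR._+_ SR.1# (SR.-_ (SR._*_ (constant c) (x i))))
                   (S.a₁,a₂,⋯ (toℕ j ∸ μ ⟨ toℕ j ⟩))))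

    schur-Det : ∀ ν β → detₛ (schurMatrix ν) β ≈ Det (map δ (toList β)) (exponents N (parts ν))
    schur-Det ν β = begin
      detₛ (schurMatrix ν) β
        ≈⟨ detₛ≈Det δ col {schurMatrix ν} (λ i j α →
             trans (x-^ i (col j) α) (inVariable-cong i (δ-sym (col j)) α)) β ⟩
      Det (map δ (toList β)) (tabulate col)
        ≡⟨ ≡.cong (Det (map δ (toList β))) (exponents-tabulate N (parts ν)) ⟩
      Det (map δ (toList β)) (exponents N (parts ν)) ∎
      where
      col : Fin N → ℕ
      col j = ν ⟨ toℕ j ⟩ ℕ.+ (N ∸ suc (toℕ j))

    module _ (μ : Partition) where

      -- The coefficient at the power b of the series in column j: the monomial takes μⱼ + N - 1 - j
      -- of the degree and the weight receives the rest.
      dualRow : ℕ → ℕ → Carrier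
      dualRow b j = weight μ (b ⊖ (μ ⟨ j ⟩ ℕ.+ (N ∸ suc j))) j

      dual-factor : ∀ (i : Fin N) j α →
        (if does (j <? diagonal μ)
         then ∏ₛ (map (λ c → geometric c i) (columnH μ j))
         else ∏ₛ (map (λ c → SR._+_ SR.1# (SR.-_ (SR._*_ (constant c) (x i)))) (columnE μ j))) α ≈
        inVariable i (λ k → weight μ (+ k) j) α
      dual-factor i j α with does (j <? diagonal μ)
      ... | true  = ∏-geometric i (columnH μ j) α
      ... | false = ∏-linear i (columnE μ j) α

      dual-entry : ∀ i j α → dualMatrix μ i j α ≈ inVariable i (λ k → dualRow k (toℕ j)) α
      dual-entry i j α = begin
        dualMatrix μ i j α
          ≈⟨ *ₛ-cong (x-^ i m) (dual-factor i (toℕ j)) α ⟩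
        SR._*_ (inVariable i (δ m)) (inVariable i (λ k → weight μ (+ k) (toℕ j))) α
          ≈⟨ inVariable-* i (δ m) (λ k → weight μ (+ k) (toℕ j)) α ⟩
        inVariable i (convolution (δ m) (λ k → weight μ (+ k) (toℕ j))) α
          ≈⟨ inVariable-cong i (λ k → trans (convolution-δ m _ k)
               (shift-⊖ (λ z → weight μ z (toℕ j)) (λ k → weight-negative μ k (toℕ j)) m k)) α ⟩
        inVariable i (λ k → dualRow k (toℕ j)) α ∎
        where
        m = μ ⟨ toℕ j ⟩ ℕ.+ (N ∸ suc (toℕ j))

      dual-Det : ∀ β → detₛ (dualMatrix μ) β ≈ Det (map dualRow (toList β)) (range 0 N)
      dual-Det β = trans (detₛ≈Det dualRow toℕ {dualMatrix μ} dual-entry β)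
        (reflexive (≡.cong (Det (map dualRow (toList β))) (≡.trans (tabulate-range id 0 N) (map-id-range 0 N))))

      Det-dualRow : ℓ μ ≤ N → ∀ ν → ℓ ν ≤ N →
        Det (map dualRow (exponents N (parts ν))) (range 0 N) ≈ S.expansion μ ν
      Det-dualRow ℓμ≤N ν ℓν≤N = begin
        Det (map dualRow (exponents N (parts ν))) (range 0 N)
          ≡⟨ ≡.cong (λ is → Det (map dualRow is) (range 0 N))
              (≡.trans (≡.sym (exponents-tabulate N (parts ν))) (tabulate-range exponent 0 N)) ⟩
        Det (map dualRow (map exponent (range 0 N))) (range 0 N)
          ≈⟨ Det-cong (range-upper 0 N) (pointwise (range-upper 0 N)) ⟩
        coefficient μ ν N
          ≈⟨ expansion≈coefficient μ ν ℓμ≤N ℓν≤N ⟨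
        S.expansion μ ν ∎
        where
        exponent : ℕ → ℕ
        exponent i = ν ⟨ i ⟩ ℕ.+ (N ∸ suc i)
        pointwise : ∀ {is} → All (_< N) is → Pointwise (λ r r′ → ∀ {j} → j < N → r j ≈ r′ j)
          (map dualRow (map exponent is)) (map (entry μ ν) is)
        pointwise []                = []
        pointwise {i ∷ _} (i<N ∷ p) = (λ {j} j<N → reflexive (≡.cong (λ z → weight μ z j)
          (≡.trans (exponent-difference (ν ⟨ i ⟩) (μ ⟨ j ⟩) i<N j<N) (≡.sym (index≡⊖ (ν ⟨ i ⟩) (μ ⟨ j ⟩) i j))))) ∷ pointwise p

      -- For ℓ(ν) > N the Schur polynomial is 0 by definition, whereas `exponents N` would discard
      -- parts of ν and its determinant need not vanish. Setting the coefficient to 0 removes these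
      -- terms.
      truncated : Partition → Carrier
      truncated ν = if does (ℓ ν ≤? N) then S.expansion μ ν else 0#

      schurTerm : ∀ ν α → truncated ν * (detₛ (schurMatrix ν) /Vandermonde) α ≈
        S.expansion μ ν * S.schurPolynomial ν N α
      schurTerm ν α with does (ℓ ν ≤? N)
      ... | true  = refl
      ... | false = trans (zeroˡ _) (sym (zeroʳ _))

      -- Both sides alternate in bs, so only strictly decreasing bs matter; there the sum has
      -- the single nonzero term with exponents N ν = bs.
      Cauchy–Binet : ℓ μ ≤ N → ∀ m bs → length bs ≡ N × ℕ.sum bs ≡ staircase N ℕ.+ m →
        Det (map dualRow bs) (range 0 N) ≈
        ∑ (map (λ ν → truncated ν * Det (map δ bs) (exponents N (parts ν))) (partitionsOf m))
      Cauchy–Binet ℓμ≤N m bs t = trans (+-inverseˡ-unique _ _ (alternating-vanish T closed alternating vanish bs t)) (-‿involutive _)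
        where
        T : List ℕ → Set
        T bs = length bs ≡ N × ℕ.sum bs ≡ staircase N ℕ.+ m

        closed : SwapClosed T
        closed xs b c ys (len , sum≡) =
          ≡.trans (≡.sym (length-swap xs)) len , ≡.trans (≡.sym (sum-swap xs b c ys)) sum≡

        term : List ℕ → Partition → Carrier
        term bs ν = truncated ν * Det (map δ bs) (exponents N (parts ν))

        alternating : Alternating (λ bs → Det (map dualRow bs) (range 0 N) + - ∑ (map (term bs) (partitionsOf m)))
        alternating = alternating-+ (Det-alternating dualRow (range 0 N))
          (alternating-neg (alternating-∑ (λ ν → alternating-* (truncated ν) (Det-alternating δ (exponents N (parts ν)))) (partitionsOf m)))

        vanish : ∀ {n bs} → Descending n bs → T bs →
          Det (map dualRow bs) (range 0 N) + - ∑ (map (term bs) (partitionsOf m)) ≈ 0#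
        vanish {bs = bs} d (≡.refl , sum≡) with exponents-surjective d
        ... | ν , ℓν≤N , exponents≡bs = trans (+-congˡ (-‿cong sum≈)) (trans (+-congˡ (-‿cong (sym dual≈))) (-‿inverseʳ _))
          where
          dual≈ : Det (map dualRow bs) (range 0 N) ≈ S.expansion μ ν
          dual≈ = trans (reflexive (≡.cong (λ cs → Det (map dualRow cs) (range 0 N)) (≡.sym exponents≡bs)))
            (Det-dualRow ℓμ≤N ν ℓν≤N)

          off : ∀ ν′ → parts ν′ ≢ parts ν → term bs ν′ ≈ 0#
          off ν′ ν′≢ν = cases (ℓ ν′ ≤? N)
            where
            cases : Dec (ℓ ν′ ≤ N) → term bs ν′ ≈ 0#
            cases (no ℓ≰N)  = 0*x≈0 (reflexive (if-no (ℓ ν′ ≤? N) ℓ≰N))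
            cases (yes ℓ≤N) = x*0≈0 (Det-δ-≢ d (proj₂ (exponents-descending N ν′))
              (λ bs≡ → ν′≢ν (exponents-injective N (positive ν′) (positive ν) ℓ≤N ℓν≤N
                (≡.trans (≡.sym bs≡) (≡.sym exponents≡bs)))))

          sum≈ : ∑ (map (term bs) (partitionsOf m)) ≈ S.expansion μ ν
          sum≈ = begin
            ∑ (map (term bs) (partitionsOf m))
              ≈⟨ ∑-partitionsOf m (term bs) ν
                   (ℕ.+-cancelˡ-≡ (staircase N) _ _ (≡.trans (≡.sym (sum-exponents N (parts ν) ℓν≤N))
                     (≡.trans (≡.cong ℕ.sum exponents≡bs) sum≡)))
                   -- `term bs` reads only the parts of a partition, so equal parts give the same
                   -- term by computation.
                   off (λ { (partition _ _ _) ≡.refl → refl }) ⟩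
            truncated ν * Det (map δ bs) (exponents N (parts ν))
              ≈⟨ *-cong (reflexive (if-yes (ℓ ν ≤? N) ℓν≤N))
                   (trans (reflexive (≡.cong (Det (map δ bs)) exponents≡bs)) (Det-δ-≡ d)) ⟩
            S.expansion μ ν * 1#
              ≈⟨ *-identityʳ _ ⟩
            S.expansion μ ν ∎

      restriction : ∀ α → S._↾_ (S.expansion μ) N α ≈ S.dualSchurSeries μ N α
      restriction α = cases (ℓ μ ≤? N)
        where
        νs = partitionsOf (Vec.sum α)

        cases : Dec (ℓ μ ≤ N) → S._↾_ (S.expansion μ) N α ≈ S.dualSchurSeries μ N α
        cases (yes ℓμ≤N) = begin
          ∑ (map (λ ν → S.expansion μ ν * S.schurPolynomial ν N α) νs)
            ≈⟨ ∑-cong (λ ν → schurTerm ν α) νs ⟨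
          ∑ (map (λ ν → truncated ν * (detₛ (schurMatrix ν) /Vandermonde) α) νs)
            ≈⟨ /Vandermonde-∑ truncated (λ ν → detₛ (schurMatrix ν)) νs (detₛ (dualMatrix μ)) α (λ β ∣β∣ → begin
              detₛ (dualMatrix μ) β
                ≈⟨ dual-Det β ⟩
              Det (map dualRow (toList β)) (range 0 N)
                ≈⟨ Cauchy–Binet ℓμ≤N (Vec.sum α) (toList β)
                     (Vec.length-toList β , ≡.trans (sum-toList β) ∣β∣) ⟩
              ∑ (map (λ ν → truncated ν * Det (map δ (toList β)) (exponents N (parts ν))) νs)
                ≈⟨ ∑-cong (λ ν → *-congˡ (schur-Det ν β)) νs ⟨
              ∑ (map (λ ν → truncated ν * detₛ (schurMatrix ν) β) νs) ∎) ⟨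
          (detₛ (dualMatrix μ) /Vandermonde) α
            ≡⟨ ≡.cong (λ (f : Series) → f α) dualSchurSeries≡ ⟨
          S.dualSchurSeries μ N α ∎
          where
          dualSchurSeries≡ : S.dualSchurSeries μ N ≡ detₛ (dualMatrix μ) /Vandermonde
          dualSchurSeries≡ = if-yes (ℓ μ ≤? N) ℓμ≤N
        -- The dual series is 0 by definition. A ν containing μ has more than N parts, so its Schur
        -- polynomial is 0; for any other ν the coefficient is 0.
        cases (no ℓμ≰N) = trans
          (∑-0 (λ ν → term≈0 ν (μ ⊆? ν)) νs)
          (reflexive (≡.sym (≡.cong (λ (f : Series) → f α) dualSchurSeries≡0)))
          where
          dualSchurSeries≡0 : S.dualSchurSeries μ N ≡ SR.0#
          dualSchurSeries≡0 = if-no (ℓ μ ≤? N) ℓμ≰N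
          schurPolynomial≡0 : ∀ ν → μ ⊆ ν → S.schurPolynomial ν N ≡ SR.0#
          schurPolynomial≡0 ν μ⊆ν = if-no (ℓ ν ≤? N) (λ ℓν≤N → ℓμ≰N (ℕ.≤-trans (prefix-length μ⊆ν) ℓν≤N))
          term≈0 : ∀ ν → Dec (μ ⊆ ν) → S.expansion μ ν * S.schurPolynomial ν N α ≈ 0#
          term≈0 ν (no μ⊈ν)  = 0*x≈0 (reflexive (expansion≡0 μ ν (μ⊈ν ∘ proj₁)))
          term≈0 ν (yes μ⊆ν) = x*0≈0 (reflexive (≡.cong (λ (f : Series) → f α) (schurPolynomial≡0 ν μ⊆ν)))

proposition3p12 : (μ : Partition) → IsDualSchurFunction μ (expansion μ)
proposition3p12 μ N α = Expansion.restriction ℚ[a]-commutativeRing a N μ α
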